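{- Let $n,k$ be positive integers with $k\le 3^n$. Then: if $n\ge 3$, $v_3(s(3^n,k))\le v_3(s(3^n,1))=\frac12(3^n-2n-1)$; if $n=2$, $v_3(s(3^2,k))\le v_3(s(3^2,6))=4$; if $n=1$, $v_3(s(3,k))\le v_3(s(3,2))=1$.
   Context: $s(N,K)$ denotes the unsigned Stirling number of the first kind (the number of permutations of $N$ elements with exactly $K$ disjoint cycles). For a nonzero integer $x$, $v_3(x)$ is the exponent of the largest power of $3$ dividing $x$. -}

module Defs where

open import Data.Nat using (ℕ; zero; suc; _+_; _*_; _%_; _/_)
open import Data.Nat.Properties using (_≟_)
open import Relation.Nullary using (yes; no)

stirling1 : ℕ → ℕ → ℕ
stirling1 zero    zero    = 1
stirling1 zero    (suc k) = 0
stirling1 (suc n) zero    = 0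
stirling1 (suc n) (suc k) = n * stirling1 n (suc k) + stirling1 n k

v3-aux : ℕ → ℕ → ℕ
v3-aux zero       x = 0
v3-aux (suc fuel) x with x ≟ 0
... | yes _ = 0
... | no  _ with x % 3 ≟ 0
...   | yes _ = suc (v3-aux fuel (x / 3))
...   | no  _ = 0

-- v₃(x): exponent of the largest power of 3 dividing x (meaningful for x ≠ 0;
-- fuel x suffices since 3^x > x).  Convention v₃(0) = 0 is never used below.
v3 : ℕ → ℕ
v3 x = v3-aux x x

{-# OPTIONS --safe #-}
module Submission where

-- With N = 3ⁿ, pair the factors x + j and x + (N − j) of (x + 1) ⋯ (x + N − 1): the product
-- becomes Tₙ(x² + N x) with Tₙ(z) = ∏ (z + j (N − j)) over 1 ≤ j ≤ (N − 1) / 2.  In Tₙ₊₁ the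
-- indices divisible by 3 contribute a rescaled Tₙ(z / 9), and the others a factor Uₙ of degree
-- 3ⁿ.  Grouping the indices j, N − j, N + j gives Uₙ ≡ Uₙ₋₁³ (mod 3ⁿ⁺¹), hence
-- Uₙ ≡ (z + 2)^(3ⁿ) (mod 3ⁿ⁺¹), whose coefficient of zⁱ has 3-adic valuation n − v₃(i).  In every
-- coefficient of Uₙ(z) Tₙ(z / 9) a single term has least valuation, and the same holds for the
-- expansion of Tₙ(x² + N x) in powers of x.  This gives an exact recursive formula V for the
-- valuations of the coefficients of Tₙ, and v₃(s(N, 2 l + 1)) = V n l,
-- v₃(s(N, 2 l)) = V n l + v₃(l) + n, which are at most V n 0 when n ≥ 3.

open import Defs
open import Algebra.Bundles using (CommutativeSemiring)
open import Algebra.Structures.Biased using (isCommutativeSemiringˡ)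
open import Data.Nat as ℕ using (ℕ; zero; suc; _∸_; _<_; z≤n; s≤s)
open import Data.Nat.Divisibility
open import Data.Nat.DivMod using (m≡m%n+[m/n]*n; m/n<m)
open import Data.Nat.Primality using (Prime; prime?; euclidsLemma)
import Data.Nat.Properties as ℕ
open import Data.Nat.Tactic.RingSolver using (solve-∀)
open import Data.Product using (∃; _×_; _,_)
open import Data.Sum using (inj₁; inj₂)
open import Function using (_∘_)
open import Level using (0ℓ)
open import Relation.Binary.Bundles using (Setoid)
open import Relation.Binary.Definitions using (tri<; tri≈; tri>)
open import Relation.Binary.PropositionalEquality as ≡ using (_≡_; _≢_; _≗_)
open import Relation.Nullary using (Dec; yes; no; ¬_; contradiction)
open import Relation.Nullary.Decidable using (from-yes)

-- Mere bounds on valuations would not propagate: whether one term of a convolution has strictly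
-- least valuation depends on the exact valuations one level down, so the induction on n carries
-- equalities. Two effects produce a dominant term. Rescaling `T n` adds 2 to the valuation for
-- every degree below the top, while the coefficients of `U n` with index from 1 to 3ⁿ have
-- valuation at most n; for the latter reason the congruence modulo 3ⁿ⁺¹ determines these
-- valuations. In the expansion by powers of x² + N x, each further power brings at least N² into a
-- fixed coefficient. All coefficients stay in ℕ, where a congruence is an equation f = g + d q;
-- this direction is available because the constants at level 3 N exceed j (N - j) by multiples of
-- N.

-- Finite products, sums and congruences in a commutative semiring

module Products {c ℓ} (R : CommutativeSemiring c ℓ) where
  open CommutativeSemiring R
  open import Algebra.Solver.Ring.NaturalCoefficients.Default R
  open import Relation.Binary.Reasoning.Setoid setoid

  ∏ : (ℕ → Carrier) → ℕ → Carrier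
  ∏ f zero    = 1#
  ∏ f (suc k) = ∏ f k * f k

  ∏-cong : ∀ {f g} k → (∀ j → j < k → f j ≈ g j) → ∏ f k ≈ ∏ g k
  ∏-cong zero    eq = refl
  ∏-cong (suc k) eq = *-cong (∏-cong k λ j j<k → eq j (ℕ.m<n⇒m<1+n j<k)) (eq k ℕ.≤-refl)

  ∏-+ : ∀ f a b → ∏ f (a ℕ.+ b) ≈ ∏ f a * ∏ (λ j → f (a ℕ.+ j)) b
  ∏-+ f a zero    rewrite ℕ.+-identityʳ a = sym (*-identityʳ _)
  ∏-+ f a (suc b) rewrite ℕ.+-suc a b     =
    trans (*-congʳ (∏-+ f a b)) (*-assoc _ _ _)

  ∏-head : ∀ f k → ∏ f (suc k) ≈ f 0 * ∏ (f ∘ suc) k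
  ∏-head f k = trans (∏-+ f 1 k) (*-congʳ (*-identityˡ _))

  ∏-* : ∀ f g k → ∏ (λ j → f j * g j) k ≈ ∏ f k * ∏ g k
  ∏-* f g zero    = sym (*-identityʳ _)
  ∏-* f g (suc k) = trans (*-congʳ (∏-* f g k))
    (solve 4 (λ a b u v → (a :* b) :* (u :* v) := (a :* u) :* (b :* v)) refl _ _ _ _)

  ∏-reverse : ∀ f k → ∏ f k ≈ ∏ (λ j → f (k ∸ suc j)) k
  ∏-reverse f zero    = refl
  ∏-reverse f (suc k) = begin
    ∏ f k * f k                          ≈⟨ *-congʳ (∏-reverse f k) ⟩
    ∏ (λ j → f (k ∸ suc j)) k * f k      ≈⟨ *-comm _ _ ⟩
    f k * ∏ (λ j → f (k ∸ suc j)) k      ≈⟨ ∏-head (λ j → f (suc k ∸ suc j)) k ⟨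
    ∏ (λ j → f (suc k ∸ suc j)) (suc k)  ∎

  -- Replacing the unwanted factors by 1 keeps the index range an interval, so that products over
  -- indices prime to 3 can still be cut into blocks and reversed.
  omit3 : (ℕ → Carrier) → ℕ → Carrier
  omit3 f j with 3 ∣? j
  ... | yes _ = 1#
  ... | no _  = f j

  omit3-∣ : ∀ f {j} → 3 ∣ j → omit3 f j ≈ 1#
  omit3-∣ f {j} 3∣j with 3 ∣? j
  ... | yes _  = refl
  ... | no 3∤j = contradiction 3∣j 3∤j

  omit3-∤ : ∀ f {j} → ¬ 3 ∣ j → omit3 f j ≈ f j
  omit3-∤ f {j} 3∤j with 3 ∣? j
  ... | yes 3∣j = contradiction 3∣j 3∤j
  ... | no _    = refl

  private
    3∤3m+ : ∀ m {r} → 0 < r → r < 3 → ¬ 3 ∣ 3 ℕ.* m ℕ.+ r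
    3∤3m+ m {suc r} _ r<3 3∣ = ℕ.<⇒≱ r<3 (∣⇒≤ (∣m+n∣m⇒∣n 3∣ (m∣m*n m)))

    3m+1 : ∀ m → 3 ℕ.* m ℕ.+ 1 ≡ suc (3 ℕ.* m)
    3m+1 = solve-∀
    3m+2 : ∀ m → 3 ℕ.* m ℕ.+ 2 ≡ suc (suc (3 ℕ.* m))
    3m+2 = solve-∀
    3sm : ∀ m → 3 ℕ.* suc m ≡ suc (suc (suc (3 ℕ.* m)))
    3sm = solve-∀

  -- Passing from m to m + 1 appends the indices 3 m + 2, 3 m + 3 and 3 m + 4, of which only the
  -- middle one is a multiple of 3.
  ∏-split3 : ∀ f m → ∏ (f ∘ suc) (suc (3 ℕ.* m)) ≈
             ∏ (omit3 f ∘ suc) (suc (3 ℕ.* m)) * ∏ (λ j → f (3 ℕ.* suc j)) m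
  ∏-split3 f zero = trans (*-congˡ (sym (omit3-∤ f (3∤3m+ 0 {1} (s≤s z≤n) (s≤s (s≤s z≤n)))))) (sym (*-identityʳ _))
  ∏-split3 f (suc m) = helper (3sm m) (∏-split3 f m)
    where
    -- 3 * suc m does not reduce to the successor form, hence the extra variable k
    helper : ∀ {k} → k ≡ suc (suc (suc (3 ℕ.* m))) →
             ∏ (f ∘ suc) (suc (3 ℕ.* m)) ≈
               ∏ (omit3 f ∘ suc) (suc (3 ℕ.* m)) * ∏ (λ j → f (3 ℕ.* suc j)) m →
             ∏ (f ∘ suc) (suc k) ≈ ∏ (omit3 f ∘ suc) (suc k) * (∏ (λ j → f (3 ℕ.* suc j)) m * f (3 ℕ.* suc m))
    helper ≡.refl ih = begin
      ∏ (f ∘ suc) (suc (3 ℕ.* m)) * f (2 ℕ.+ 3 ℕ.* m) * f (3 ℕ.+ 3 ℕ.* m) * f (4 ℕ.+ 3 ℕ.* m)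
        ≈⟨ *-cong (*-cong (*-cong ih (sym (omit3-∤ f 3∤a))) (reflexive (≡.cong f (≡.sym (3sm m))))) (sym (omit3-∤ f 3∤b)) ⟩
      (o * t) * a * b * d
        ≈⟨ solve 5 (λ o t a b d → (o :* t) :* a :* b :* d := (o :* a :* con 1 :* d) :* (t :* b)) refl o t a b d ⟩
      (o * a * 1# * d) * (t * b)
        ≈⟨ *-congʳ (*-congʳ (*-congˡ (sym (omit3-∣ f 3∣c)))) ⟩
      (o * a * omit3 f (3 ℕ.+ 3 ℕ.* m) * d) * (t * b) ∎
      where
      o = ∏ (omit3 f ∘ suc) (suc (3 ℕ.* m))
      t = ∏ (λ j → f (3 ℕ.* suc j)) m
      a = omit3 f (2 ℕ.+ 3 ℕ.* m)
      b = f (3 ℕ.* suc m)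
      d = omit3 f (4 ℕ.+ 3 ℕ.* m)
      3∤a : ¬ 3 ∣ 2 ℕ.+ 3 ℕ.* m
      3∤a = ≡.subst (λ i → ¬ 3 ∣ i) (3m+2 m) (3∤3m+ m (s≤s z≤n) (s≤s (s≤s (s≤s z≤n))))
      3∤b : ¬ 3 ∣ 4 ℕ.+ 3 ℕ.* m
      3∤b = ≡.subst (λ i → ¬ 3 ∣ i) (≡.trans (3m+1 (suc m)) (≡.cong suc (3sm m)))
              (3∤3m+ (suc m) (s≤s z≤n) (s≤s (s≤s z≤n)))
      3∣c : 3 ∣ 3 ℕ.+ 3 ℕ.* m
      3∣c = ≡.subst (3 ∣_) (3sm m) (m∣m*n (suc m))

  infix 4 _≋_[mod_]
  -- Without subtraction the relation is one-sided. This is enough, since it is only used to add a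
  -- multiple of d to something of known valuation.
  _≋_[mod_] : Carrier → Carrier → Carrier → Set _
  f ≋ g [mod d ] = ∃ λ q → f ≈ g + d * q

  ∏-mod : ∀ {d f g} k → (∀ j → j < k → f j ≋ g j [mod d ]) → ∏ f k ≋ ∏ g k [mod d ]
  ∏-mod zero eq = 0# , trans (sym (+-identityʳ _)) (+-congˡ (sym (zeroʳ _)))
  ∏-mod {d} (suc k) eq =
    let p , P = ∏-mod k λ j j<k → eq j (ℕ.m<n⇒m<1+n j<k)
        q , Q = eq k ℕ.≤-refl
    in _ , trans (*-cong P Q)
      (solve 5 (λ a b d p q → (a :+ d :* p) :* (b :+ d :* q) :=
                              a :* b :+ d :* (p :* b :+ a :* q :+ d :* p :* q)) refl _ _ d p q)

  -- In (g + m q)³ the linear error carries 3 m, and the others carry m², which is 3 m l because m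
  -- is itself a multiple of 3.
  cube-mod : ∀ {m l f g} → m ≈ (1# + 1# + 1#) * l → f ≋ g [mod m ] →
             f * f * f ≋ g * g * g [mod (1# + 1# + 1#) * m ]
  cube-mod {m} {l} {f} {g} m≈3l (q , f≈) = _ , (begin
    f * f * f                                         ≈⟨ *-cong (*-cong f≈ f≈) f≈ ⟩
    (g + m * q) * (g + m * q) * (g + m * q)
      ≈⟨ solve 3 (λ g m q → (g :+ m :* q) :* (g :+ m :* q) :* (g :+ m :* q) :=
           g :* g :* g :+ con 3 :* m :* (g :* g :* q)
             :+ m :* (m :* (con 3 :* g :* q :* q :+ m :* q :* q :* q))) refl g m q ⟩
    _ + m * (m * r)                                   ≈⟨ +-congˡ (*-congʳ m≈3l) ⟩
    _ + (1# + 1# + 1#) * l * (m * r)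
      ≈⟨ solve 5 (λ g m q l r →
           g :* g :* g :+ con 3 :* m :* (g :* g :* q)
             :+ con 3 :* l :* (m :* r) :=
           g :* g :* g :+ con 3 :* m :* (g :* g :* q :+ l :* r)) refl g m q l r ⟩
    _ ∎)
    where r = _

  -- The linear error 2 m w² (j + j′ + m) equals 4 m² w², so every error term contains m², which is
  -- 3 m l.
  triple-mod : ∀ {m l j j′} w → m ≈ (1# + 1# + 1#) * l → j + j′ ≈ m →
               (w + (m + m) * j) * (w + (m + m) * j′) * (w + (m + m) * m)
                 ≋ w * w * w [mod (1# + 1# + 1#) * m ]
  triple-mod {m} {l} {j} {j′} w m≈3l j+j′≈m = _ , (begin
    (w + (m + m) * j) * (w + (m + m) * j′) * (w + (m + m) * m)
      ≈⟨ solve 4 (λ w m j k →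
           (w :+ (m :+ m) :* j) :* (w :+ (m :+ m) :* k) :* (w :+ (m :+ m) :* m) :=
           w :* w :* w :+ con 2 :* (m :* (w :* w) :* (j :+ k))
             :+ (m :* m) :* (con 2 :* w :* w :+ con 4 :* w :* m :* (j :+ k) :+ con 4 :* j :* k :* (w :+ con 2 :* m :* m)))
           refl w m j j′ ⟩
    w * w * w + (1# + 1#) * (m * (w * w) * (j + j′)) + m * m * r
      ≈⟨ +-congʳ (+-congˡ (*-congˡ (*-congˡ j+j′≈m))) ⟩
    w * w * w + (1# + 1#) * (m * (w * w) * m) + m * m * r
      ≈⟨ solve 3 (λ w m r →
           w :* w :* w :+ con 2 :* (m :* (w :* w) :* m) :+ m :* m :* r :=
           w :* w :* w :+ m :* (m :* (con 2 :* w :* w :+ r)))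
           refl w m r ⟩
    w * w * w + m * (m * s) ≈⟨ +-congˡ (*-congʳ m≈3l) ⟩
    w * w * w + (1# + 1# + 1#) * l * (m * s)
      ≈⟨ solve 4 (λ w m l s → w :* w :* w :+ con 3 :* l :* (m :* s) :=
                              w :* w :* w :+ con 3 :* m :* (l :* s)) refl w m l s ⟩
    w * w * w + (1# + 1# + 1#) * m * (l * s) ∎)
    where
    r = _
    s = _

  vieta-pair : ∀ x j j′ → (x + j) * (x + j′) ≈ x * (x + (j + j′)) + j * j′
  vieta-pair = solve 3 (λ x j k → (x :+ j) :* (x :+ k) := x :* (x :+ (j :+ k)) :+ j :* k) refl

  ∑ : (ℕ → Carrier) → ℕ → Carrier
  ∑ f zero    = 0#
  ∑ f (suc k) = ∑ f k + f k

  ∑-cong : ∀ {f g} k → (∀ j → f j ≈ g j) → ∑ f k ≈ ∑ g k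
  ∑-cong zero    eq = refl
  ∑-cong (suc k) eq = +-cong (∑-cong k eq) (eq k)

  ∑-head : ∀ f k → ∑ f (suc k) ≈ f 0 + ∑ (f ∘ suc) k
  ∑-head f zero    = +-comm _ _
  ∑-head f (suc k) = trans (+-congʳ (∑-head f k)) (+-assoc _ _ _)

  ∑-distrib-+ : ∀ f g k → ∑ (λ j → f j + g j) k ≈ ∑ f k + ∑ g k
  ∑-distrib-+ f g zero    = sym (+-identityˡ _)
  ∑-distrib-+ f g (suc k) = trans (+-congʳ (∑-distrib-+ f g k))
    (solve 4 (λ a b u v → (a :+ b) :+ (u :+ v) := (a :+ u) :+ (b :+ v)) refl _ _ _ _)

  ∑-distribʳ-* : ∀ f c k → ∑ f k * c ≈ ∑ (λ j → f j * c) k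
  ∑-distribʳ-* f c zero    = zeroˡ c
  ∑-distribʳ-* f c (suc k) = trans (distribʳ _ _ _) (+-congʳ (∑-distribʳ-* f c k))

open import Data.Nat using (_+_; _*_; _^_; _/_; _%_; _≤_; _≤?_; _≟_; >-nonZero; ≢-nonZero)
open import Data.Nat.Properties
open import Relation.Binary.PropositionalEquality

-- Formal power series over ℕ

Series : Set
Series = ℕ → ℕ

infixl 6 _⊕_
infixl 7 _⊛_

_⊕_ _⊛_ : Series → Series → Series
(f ⊕ g) k = f k + g k
(f ⊛ g) zero    = f 0 * g 0
(f ⊛ g) (suc k) = f 0 * g (suc k) + (f ∘ suc ⊛ g) k

const : ℕ → Series
const c zero    = c
const c (suc _) = 0

X : Series
X zero          = 0
X (suc zero)    = 1
X (suc (suc _)) = 0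

⊛-cong : ∀ {f f′ g g′} → f ≗ f′ → g ≗ g′ → f ⊛ g ≗ f′ ⊛ g′
⊛-cong f≗ g≗ zero    = cong₂ _*_ (f≗ 0) (g≗ 0)
⊛-cong f≗ g≗ (suc k) = cong₂ _+_ (cong₂ _*_ (f≗ 0) (g≗ (suc k))) (⊛-cong (f≗ ∘ suc) g≗ k)

⊛-distribʳ : ∀ h f g → (f ⊕ g) ⊛ h ≗ f ⊛ h ⊕ g ⊛ h
⊛-distribʳ h f g zero    = *-distribʳ-+ (h 0) (f 0) (g 0)
⊛-distribʳ h f g (suc k) = begin
  (f 0 + g 0) * h (suc k) + ((f ⊕ g) ∘ suc ⊛ h) k
    ≡⟨ cong ((f 0 + g 0) * h (suc k) +_) (⊛-distribʳ h (f ∘ suc) (g ∘ suc) k) ⟩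
  (f 0 + g 0) * h (suc k) + ((f ∘ suc ⊛ h) k + (g ∘ suc ⊛ h) k)
    ≡⟨ rearrange (f 0) (g 0) (h (suc k)) _ _ ⟩
  f 0 * h (suc k) + (f ∘ suc ⊛ h) k + (g 0 * h (suc k) + (g ∘ suc ⊛ h) k) ∎
  where
  open ≡-Reasoning
  rearrange : ∀ a b c x y → (a + b) * c + (x + y) ≡ a * c + x + (b * c + y)
  rearrange = solve-∀

-- The product is defined by peeling the first factor; peeling the second one as well is what makes
-- commutativity an induction.
⊛-suc : ∀ f g k → (f ⊛ g) (suc k) ≡ (f ⊛ g ∘ suc) k + f (suc k) * g 0
⊛-suc f g zero    = refl
⊛-suc f g (suc k) = trans (cong (f 0 * g (suc (suc k)) +_) (⊛-suc (f ∘ suc) g k))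
                          (sym (+-assoc (f 0 * g (suc (suc k))) _ _))

⊛-comm : ∀ f g → f ⊛ g ≗ g ⊛ f
⊛-comm f g zero    = *-comm (f 0) (g 0)
⊛-comm f g (suc k) = begin
  f 0 * g (suc k) + (f ∘ suc ⊛ g) k ≡⟨ cong₂ _+_ (*-comm (f 0) _) (⊛-comm (f ∘ suc) g k) ⟩
  g (suc k) * f 0 + (g ⊛ f ∘ suc) k ≡⟨ +-comm (g (suc k) * f 0) _ ⟩
  (g ⊛ f ∘ suc) k + g (suc k) * f 0 ≡⟨ ⊛-suc g f k ⟨
  (g ⊛ f) (suc k)                   ∎
  where open ≡-Reasoning

*-⊛ : ∀ c f g → (λ k → c * f k) ⊛ g ≗ λ k → c * (f ⊛ g) k
*-⊛ c f g zero    = *-assoc c (f 0) (g 0)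
*-⊛ c f g (suc k) = trans (cong₂ _+_ (*-assoc c (f 0) _) (*-⊛ c (f ∘ suc) g k))
                          (sym (*-distribˡ-+ c (f 0 * g (suc k)) _))

⊛-zeroˡ : ∀ f → (λ _ → 0) ⊛ f ≗ λ _ → 0
⊛-zeroˡ f zero    = refl
⊛-zeroˡ f (suc k) = ⊛-zeroˡ f k

const-⊛ : ∀ c f → const c ⊛ f ≗ λ k → c * f k
const-⊛ c f zero    = refl
const-⊛ c f (suc k) = trans (cong (c * f (suc k) +_) (⊛-zeroˡ f k)) (+-identityʳ _)

⊛-assoc : ∀ f g h → (f ⊛ g) ⊛ h ≗ f ⊛ (g ⊛ h)
⊛-assoc f g h zero    = *-assoc (f 0) (g 0) (h 0)
⊛-assoc f g h (suc k) = begin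
  f 0 * g 0 * h (suc k) + ((f ⊛ g) ∘ suc ⊛ h) k
    ≡⟨ cong (f 0 * g 0 * h (suc k) +_) (⊛-distribʳ h (λ j → f 0 * g (suc j)) (f ∘ suc ⊛ g) k) ⟩
  f 0 * g 0 * h (suc k) + (((λ j → f 0 * g (suc j)) ⊛ h) k + ((f ∘ suc ⊛ g) ⊛ h) k)
    ≡⟨ cong (f 0 * g 0 * h (suc k) +_) (cong₂ _+_ (*-⊛ (f 0) (g ∘ suc) h k) (⊛-assoc (f ∘ suc) g h k)) ⟩
  f 0 * g 0 * h (suc k) + (f 0 * (g ∘ suc ⊛ h) k + (f ∘ suc ⊛ (g ⊛ h)) k)
    ≡⟨ rearrange (f 0) (g 0) (h (suc k)) _ _ ⟩
  f 0 * (g 0 * h (suc k) + (g ∘ suc ⊛ h) k) + (f ∘ suc ⊛ (g ⊛ h)) k ∎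
  where
  open ≡-Reasoning
  rearrange : ∀ a b c x y → a * b * c + (a * x + y) ≡ a * (b * c + x) + y
  rearrange = solve-∀

⊛-commutativeSemiring : CommutativeSemiring 0ℓ 0ℓ
⊛-commutativeSemiring = record
  { Carrier = Series
  ; _≈_ = _≗_
  ; _+_ = _⊕_
  ; _*_ = _⊛_
  ; 0#  = λ _ → 0
  ; 1#  = const 1
  ; isCommutativeSemiring = isCommutativeSemiringˡ record
    { +-isCommutativeMonoid = record
      { isMonoid = record
        { isSemigroup = record
          { isMagma = record
            { isEquivalence = Setoid.isEquivalence (ℕ →-setoid ℕ)
            ; ∙-cong = λ p q k → cong₂ _+_ (p k) (q k)
            }
          ; assoc = λ f g h k → +-assoc (f k) (g k) (h k)
          }
        ; identity = (λ f k → refl) , λ f k → +-identityʳ (f k)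
        }
      ; comm = λ f g k → +-comm (f k) (g k)
      }
    ; *-isCommutativeMonoid = record
      { isMonoid = record
        { isSemigroup = record
          { isMagma = record
            { isEquivalence = Setoid.isEquivalence (ℕ →-setoid ℕ)
            ; ∙-cong = ⊛-cong
            }
          ; assoc = ⊛-assoc
          }
        ; identity = (λ f k → trans (const-⊛ 1 f k) (+-identityʳ (f k)))
                   , λ f k → trans (⊛-comm f (const 1) k) (trans (const-⊛ 1 f k) (+-identityʳ (f k)))
        }
      ; comm = ⊛-comm
      }
    ; distribʳ = ⊛-distribʳ
    ; zeroˡ = ⊛-zeroˡ
    }
  }
module S = CommutativeSemiring ⊛-commutativeSemiring
open Products ⊛-commutativeSemiring
import Relation.Binary.Reasoning.Setoid S.setoid as ≗-Reasoning

const-+ : ∀ a b → const (a + b) ≗ const a ⊕ const b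
const-+ a b zero    = refl
const-+ a b (suc k) = refl

const-* : ∀ a b → const (a * b) ≗ const a ⊛ const b
const-* a b zero    = refl
const-* a b (suc k) = sym (trans (const-⊛ a (const b) (suc k)) (*-zeroʳ a))

X-⊛-suc : ∀ f k → (X ⊛ f) (suc k) ≡ f k
X-⊛-suc f k = trans (⊛-cong {g = f} X≗ (λ _ → refl) k) (trans (const-⊛ 1 f k) (*-identityˡ _))
  where
  X≗ : X ∘ suc ≗ const 1
  X≗ zero    = refl
  X≗ (suc _) = refl

X+ : ℕ → Series
X+ a = X ⊕ const a

X+-⊛-suc : ∀ a f k → (X+ a ⊛ f) (suc k) ≡ f k + a * f (suc k)
X+-⊛-suc a f k = trans (⊛-distribʳ f X (const a) (suc k))
                       (cong₂ _+_ (X-⊛-suc f k) (const-⊛ a f (suc k)))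

∏-X+-suc : ∀ (a : ℕ → ℕ) k i →
           ∏ (X+ ∘ a) (suc k) (suc i) ≡ ∏ (X+ ∘ a) k i + a k * ∏ (X+ ∘ a) k (suc i)
∏-X+-suc a k i = trans (⊛-comm (∏ (X+ ∘ a) k) (X+ (a k)) (suc i)) (X+-⊛-suc (a k) (∏ (X+ ∘ a) k) i)

∏-X+-> : ∀ a k {i} → k < i → ∏ (X+ ∘ a) k i ≡ 0
∏-X+-> a zero    {suc i} _       = refl
∏-X+-> a (suc k) {suc i} (s≤s k<i)
  rewrite ∏-X+-suc a k i | ∏-X+-> a k k<i | ∏-X+-> a k (m<n⇒m<1+n k<i) = *-zeroʳ (a k)

∏-X+-monic : ∀ a k → ∏ (X+ ∘ a) k k ≡ 1
∏-X+-monic a zero = refl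
∏-X+-monic a (suc k)
  rewrite ∏-X+-suc a k k | ∏-X+-monic a k | ∏-X+-> a k (n<1+n k) = cong suc (*-zeroʳ (a k))

-- With i + d factors, the coefficient of index i is the elementary symmetric polynomial of degree d
-- in the `a j`, hence homogeneous of degree d.
∏-X+-scale : ∀ c a i d →
             ∏ (λ j → X+ (c * a j)) (i + d) i ≡ c ^ d * ∏ (X+ ∘ a) (i + d) i
∏-X+-scale c a zero zero = refl
∏-X+-scale c a zero (suc d) = begin
  ∏ (λ j → X+ (c * a j)) d 0 * (c * a d)   ≡⟨ cong (_* (c * a d)) (∏-X+-scale c a zero d) ⟩
  c ^ d * ∏ (X+ ∘ a) d 0 * (c * a d)       ≡⟨ rearrange (c ^ d) _ c (a d) ⟩
  c * c ^ d * (∏ (X+ ∘ a) d 0 * a d)       ∎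
  where
  open ≡-Reasoning
  rearrange : ∀ x y c a → x * y * (c * a) ≡ c * x * (y * a)
  rearrange = solve-∀
∏-X+-scale c a (suc i) zero
  rewrite +-identityʳ i
        | ∏-X+-monic (λ j → c * a j) (suc i) | ∏-X+-monic a (suc i) = refl
∏-X+-scale c a (suc i) (suc d) = begin
  ∏ (λ j → X+ (c * a j)) (suc i + suc d) (suc i)
    ≡⟨ ∏-X+-suc (λ j → c * a j) (i + suc d) i ⟩
  ∏ (λ j → X+ (c * a j)) (i + suc d) i + c * a (i + suc d) * ∏ (λ j → X+ (c * a j)) (i + suc d) (suc i)
    ≡⟨ cong₂ (λ x y → x + c * a (i + suc d) * y) (∏-X+-scale c a i (suc d))
         (subst (λ k → ∏ (λ j → X+ (c * a j)) k (suc i) ≡ c ^ d * ∏ (X+ ∘ a) k (suc i))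
           (sym (+-suc i d)) (∏-X+-scale c a (suc i) d)) ⟩
  c ^ suc d * ∏ (X+ ∘ a) (i + suc d) i + c * a (i + suc d) * (c ^ d * ∏ (X+ ∘ a) (i + suc d) (suc i))
    ≡⟨ rearrange c (c ^ d) _ (a (i + suc d)) _ ⟩
  c ^ suc d * (∏ (X+ ∘ a) (i + suc d) i + a (i + suc d) * ∏ (X+ ∘ a) (i + suc d) (suc i))
    ≡⟨ cong (c ^ suc d *_) (∏-X+-suc a (i + suc d) i) ⟨
  c ^ suc d * ∏ (X+ ∘ a) (suc i + suc d) (suc i) ∎
  where
  open ≡-Reasoning
  rearrange : ∀ c x y a z → c * x * y + c * a * (x * z) ≡ c * x * (y + a * z)
  rearrange = solve-∀

stirling1≡∏ : ∀ n → stirling1 n ≗ ∏ X+ n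
stirling1≡∏ zero    zero    = refl
stirling1≡∏ zero    (suc k) = refl
stirling1≡∏ (suc n) zero    = sym (∏-zero n)
  where
  ∏-zero : ∀ n → ∏ X+ (suc n) 0 ≡ 0
  ∏-zero zero    = refl
  ∏-zero (suc n) = cong (_* suc n) (∏-zero n)
stirling1≡∏ (suc n) (suc k) = begin
  n * stirling1 n (suc k) + stirling1 n k ≡⟨ +-comm (n * stirling1 n (suc k)) _ ⟩
  stirling1 n k + n * stirling1 n (suc k) ≡⟨ cong₂ _+_ (stirling1≡∏ n k) (cong (n *_) (stirling1≡∏ n (suc k))) ⟩
  ∏ X+ n k + n * ∏ X+ n (suc k)           ≡⟨ ∏-X+-suc (λ j → j) n k ⟨
  ∏ X+ (suc n) (suc k)                    ∎
  where open ≡-Reasoning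

-- The polynomials T and U

-- This is (3ⁿ - 1) / 2, given by a recursion whose successor case has the shape 3 m + 1 of
-- `∏-split3`.
half : ℕ → ℕ
half zero    = 0
half (suc n) = suc (3 * half n)

3^≡1+2half : ∀ n → 3 ^ n ≡ suc (half n + half n)
3^≡1+2half zero    = refl
3^≡1+2half (suc n) = trans (cong (3 *_) (3^≡1+2half n)) (lemma (half n))
  where
  lemma : ∀ h → 3 * suc (h + h) ≡ suc (suc (3 * h) + suc (3 * h))
  lemma = solve-∀

half-suc : ∀ n → half (suc n) ≡ half n + 3 ^ n
half-suc n = trans (lemma (half n)) (cong (half n +_) (sym (3^≡1+2half n)))
  where
  lemma : ∀ h → suc (3 * h) ≡ h + suc (h + h)
  lemma = solve-∀

-- Used after reversing the upper half of 1, ..., 3ⁿ - 1, which places 3ⁿ - (j + 1) opposite j + 1.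
half-reflect : ∀ n {j} → j < half n → suc (half n + (half n ∸ suc j)) ≡ 3 ^ n ∸ suc j
half-reflect n {j} j<h = begin
  suc (half n + (half n ∸ suc j)) ≡⟨ cong suc (+-∸-assoc (half n) j<h) ⟨
  suc (half n + half n ∸ suc j)   ≡⟨ +-∸-assoc 1 (≤-trans j<h (m≤m+n (half n) (half n))) ⟨
  suc (half n + half n) ∸ suc j   ≡⟨ cong (_∸ suc j) (3^≡1+2half n) ⟨
  3 ^ n ∸ suc j                   ∎
  where open ≡-Reasoning

node : ℕ → ℕ → ℕ
node N j = j * (N ∸ j)

-- U n is the factor of T (suc n) coming from the indices not divisible by 3.
T U : ℕ → Series
T n = ∏ (λ j → X+ (node (3 ^ n) (suc j))) (half n)
U n = ∏ (omit3 (X+ ∘ node (3 ^ suc n)) ∘ suc) (half (suc n))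

T-suc : ∀ n → T (suc n) ≗ U n ⊛ ∏ (λ j → X+ (9 * node (3 ^ n) (suc j))) (half n)
T-suc n = S.trans (∏-split3 (X+ ∘ node (3 ^ suc n)) (half n))
  (S.*-congˡ {U n} (∏-cong (half n) λ j _ k → cong (λ a → X+ a k) (node-3* (suc j))))
  where
  rearrange : ∀ a b → 3 * a * (3 * b) ≡ 9 * (a * b)
  rearrange = solve-∀
  node-3* : ∀ j → node (3 * 3 ^ n) (3 * j) ≡ 9 * node (3 ^ n) j
  node-3* j = trans (cong (3 * j *_) (sym (*-distribˡ-∸ 3 (3 ^ n) j))) (rearrange j _)

const-3 : ∀ a → (const 1 ⊕ const 1 ⊕ const 1) ⊛ const a ≗ const (3 * a)
const-3 a = S.trans (S.*-congʳ {const a} 1+1+1) (S.sym (const-* 3 a))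
  where
  1+1+1 : const 1 ⊕ const 1 ⊕ const 1 ≗ const 3
  1+1+1 zero    = refl
  1+1+1 (suc _) = refl

-- modulo 3 N, each factor with index j, N − j or N + j agrees to first order in N
-- with the one of index j modulo N, and the three first-order errors cancel
node-triple : ∀ l j j′ → j + j′ ≡ 3 * l →
  let N = 3 * l ; w = X+ (node N j) in
  X+ (node (3 * N) j) ⊛ X+ (node (3 * N) j′) ⊛ X+ (node (3 * N) (N + j))
    ≋ w ⊛ w ⊛ w [mod const (3 * N) ]
node-triple l j j′ j+j′≡N with 3 * l | const-* 3 l | j+j′≡N
-- Matching identifies N with j + j′, so every node becomes a product of sums and the identities
-- below are free of subtraction.
... | N | 3⊛l | refl =
  let q , eq = triple-mod {const N} {const l} {const j} {const j′} (X+ (node N j))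
                 (S.trans 3⊛l (S.trans (S.sym (const-* 3 l)) (S.sym (const-3 l))))
                 (S.sym (const-+ j j′))
  in q , (begin
    X+ (node (3 * N) j) ⊛ X+ (node (3 * N) j′) ⊛ X+ (node (3 * N) (N + j))
      ≈⟨ S.*-cong (S.*-cong factor₁ factor₂) factor₃ ⟩
    _ ≈⟨ eq ⟩
    w ⊛ w ⊛ w ⊕ (const 1 ⊕ const 1 ⊕ const 1) ⊛ const N ⊛ q
      ≈⟨ S.+-congˡ {w ⊛ w ⊛ w} (S.*-congʳ {q} (const-3 N)) ⟩
    w ⊛ w ⊛ w ⊕ const (3 * N) ⊛ q ∎)
  where
  open ≗-Reasoning
  w = X+ (node N j)
  node-+ : ∀ i x → node (i + x) i ≡ i * x
  node-+ i x = cong (i *_) (m+n∸m≡n i x)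
  -- For the indices j, j′ and N + j the node exceeds j j′ by 2 N j, 2 N j′ and 2 N N, the shape
  -- that `triple-mod` expects.
  factor : ∀ i r x → 3 * N ≡ i + x → i * x ≡ j * j′ + (N + N) * r →
           X+ (node (3 * N) i) ≗ w ⊕ (const N ⊕ const N) ⊛ const r
  factor i r x 3N≡i+x ix≡ rewrite 3N≡i+x | node-+ i x | node-+ j j′ | ix≡ = begin
    X ⊕ const (j * j′ + (N + N) * r)
      ≈⟨ S.+-congˡ {X} (S.trans (const-+ (j * j′) _) (S.+-congˡ {const (j * j′)}
           (S.trans (const-* (N + N) r) (S.*-congʳ {const r} (const-+ N N))))) ⟩
    X ⊕ (const (j * j′) ⊕ (const N ⊕ const N) ⊛ const r)
      ≈⟨ S.+-assoc X (const (j * j′)) _ ⟨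
    X ⊕ const (j * j′) ⊕ (const N ⊕ const N) ⊛ const r ∎
  factor₁ = factor j j (N + N + j′) (sum j j′) (product j j′)
    where
    sum : ∀ a b → 3 * (a + b) ≡ a + (a + b + (a + b) + b)
    sum = solve-∀
    product : ∀ a b → a * (a + b + (a + b) + b) ≡ a * b + (a + b + (a + b)) * a
    product = solve-∀
  factor₂ = factor j′ j′ (N + N + j) (sum j j′) (product j j′)
    where
    sum : ∀ a b → 3 * (a + b) ≡ b + (a + b + (a + b) + a)
    sum = solve-∀
    product : ∀ a b → b * (a + b + (a + b) + a) ≡ a * b + (a + b + (a + b)) * b
    product = solve-∀
  factor₃ = factor (N + j) N (N + j′) (sum j j′) (product j j′)
    where
    sum : ∀ a b → 3 * (a + b) ≡ a + b + a + (a + b + b)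
    sum = solve-∀
    product : ∀ a b → (a + b + a) * (a + b + b) ≡ a * b + (a + b + (a + b)) * (a + b)
    product = solve-∀

half-suc-split : ∀ n → half (suc (suc n)) ≡ half (suc n) + (half (suc n) + suc (half (suc n)))
half-suc-split n = lemma (half (suc n))
  where
  lemma : ∀ h → suc (3 * h) ≡ h + (h + suc h)
  lemma = solve-∀

-- As N = 2 M + 1, the range 1, ..., 3 M + 1 consists of 1, ..., M, then N - M, ..., N - 1, then N
-- (a multiple of 3, contributing 1), then N + 1, ..., N + M. Reversing the second block aligns j, N
-- - j and N + j. Since 3 divides N, either all three indices are multiples of 3 or none is, and
-- `node-triple` treats the latter case.
U-suc : ∀ n → U (suc n) ≋ U n ⊛ U n ⊛ U n [mod const (3 ^ suc (suc n)) ]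
U-suc n =
  let q , eq = ∏-mod {const (3 * N)} M triple in q , (begin
    ∏ (F ∘ suc) (suc (3 * M))
      ≈⟨ S.reflexive (cong (∏ (F ∘ suc)) (half-suc-split n)) ⟩
    ∏ (F ∘ suc) (M + (M + suc M))
      ≈⟨ ∏-+ (F ∘ suc) M (M + suc M) ⟩
    A ⊛ ∏ (λ j → F (suc (M + j))) (M + suc M)
      ≈⟨ S.*-congˡ {A} (∏-+ (λ j → F (suc (M + j))) M (suc M)) ⟩
    A ⊛ (∏ (λ j → F (suc (M + j))) M ⊛ ∏ (λ j → F (suc (M + (M + j)))) (suc M))
      ≈⟨ S.*-congˡ {A} (S.*-cong (∏-reverse (λ j → F (suc (M + j))) M) (∏-head (λ j → F (suc (M + (M + j)))) M)) ⟩
    A ⊛ (∏ (λ j → F (suc (M + (M ∸ suc j)))) M ⊛ (F (suc (M + (M + 0))) ⊛ ∏ (λ j → F (suc (M + (M + suc j)))) M))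
      ≈⟨ S.*-congˡ {A} (S.*-cong
           (∏-cong M λ j j<M → S.reflexive (cong F (half-reflect (suc n) j<M)))
           (S.trans (S.*-cong F[N] (∏-cong M λ j _ → S.reflexive (cong F (translated j)))) (S.*-identityˡ C))) ⟩
    A ⊛ (B ⊛ C)
      ≈⟨ S.*-assoc A B C ⟨
    A ⊛ B ⊛ C
      ≈⟨ S.*-congʳ {C} (∏-* (λ j → F (suc j)) (λ j → F (N ∸ suc j)) M) ⟨
    ∏ (λ j → F (suc j) ⊛ F (N ∸ suc j)) M ⊛ C
      ≈⟨ ∏-* (λ j → F (suc j) ⊛ F (N ∸ suc j)) (λ j → F (N + suc j)) M ⟨
    ∏ (λ j → F (suc j) ⊛ F (N ∸ suc j) ⊛ F (N + suc j)) M
      ≈⟨ eq ⟩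
    ∏ (λ j → G (suc j) ⊛ G (suc j) ⊛ G (suc j)) M ⊕ const (3 * N) ⊛ q
      ≈⟨ S.+-congʳ {const (3 * N) ⊛ q} (S.trans (∏-* (λ j → G (suc j) ⊛ G (suc j)) (G ∘ suc) M)
           (S.*-congʳ {U n} (∏-* (G ∘ suc) (G ∘ suc) M))) ⟩
    U n ⊛ U n ⊛ U n ⊕ const (3 * N) ⊛ q ∎)
  where
  open ≗-Reasoning
  N = 3 ^ suc n
  M = half (suc n)
  F G : ℕ → Series
  F = omit3 (X+ ∘ node (3 * N))
  G = omit3 (X+ ∘ node N)
  A = ∏ (F ∘ suc) M
  B = ∏ (λ j → F (N ∸ suc j)) M
  C = ∏ (λ j → F (N + suc j)) M

  3∣N : 3 ∣ N
  3∣N = m∣m*n (3 ^ n)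

  M≤N : ∀ {j} → j < M → suc j ≤ N
  M≤N j<M = ≤-trans j<M (subst (M ≤_) (sym (3^≡1+2half (suc n))) (m≤n⇒m≤1+n (m≤m+n M M)))

  translated : ∀ j → suc (M + (M + suc j)) ≡ N + suc j
  translated j = trans (cong suc (sym (+-assoc M M (suc j)))) (cong (_+ suc j) (sym (3^≡1+2half (suc n))))

  F[N] : F (suc (M + (M + 0))) ≗ const 1
  F[N] = omit3-∣ (X+ ∘ node (3 * N))
    (subst (3 ∣_) (trans (3^≡1+2half (suc n)) (cong suc (cong (M +_) (sym (+-identityʳ M))))) 3∣N)

  triple : ∀ j → j < M → F (suc j) ⊛ F (N ∸ suc j) ⊛ F (N + suc j)
             ≋ G (suc j) ⊛ G (suc j) ⊛ G (suc j) [mod const (3 * N) ]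
  triple j j<M = byCases (3 ∣? suc j)
    where
    byCases : Dec (3 ∣ suc j) → F (suc j) ⊛ F (N ∸ suc j) ⊛ F (N + suc j)
                ≋ G (suc j) ⊛ G (suc j) ⊛ G (suc j) [mod const (3 * N) ]
    byCases (yes 3∣j) = (λ _ → 0) , (begin
      F (suc j) ⊛ F (N ∸ suc j) ⊛ F (N + suc j)
        ≈⟨ S.*-cong (S.*-cong (omit3-∣ f 3∣j) (omit3-∣ f 3∣N∸j)) (omit3-∣ f (∣m∣n⇒∣m+n 3∣N 3∣j)) ⟩
      const 1 ⊛ const 1 ⊛ const 1
        ≈⟨ S.*-cong (S.*-cong G≗1 G≗1) G≗1 ⟨
      G (suc j) ⊛ G (suc j) ⊛ G (suc j)
        ≈⟨ S.+-identityʳ _ ⟨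
      G (suc j) ⊛ G (suc j) ⊛ G (suc j) ⊕ (λ _ → 0)
        ≈⟨ S.+-congˡ {G (suc j) ⊛ G (suc j) ⊛ G (suc j)} (S.zeroʳ (const (3 * N))) ⟨
      G (suc j) ⊛ G (suc j) ⊛ G (suc j) ⊕ const (3 * N) ⊛ (λ _ → 0) ∎)
      where
      f = X+ ∘ node (3 * N)
      G≗1 = omit3-∣ (X+ ∘ node N) 3∣j
      3∣N∸j : 3 ∣ N ∸ suc j
      3∣N∸j = ∣m+n∣m⇒∣n (subst (3 ∣_) (sym (m+[n∸m]≡n (M≤N j<M))) 3∣N) 3∣j
    byCases (no 3∤j) =
      let q , eq = node-triple (3 ^ n) (suc j) (N ∸ suc j) (m+[n∸m]≡n (M≤N j<M))
      in q , S.trans (S.*-cong (S.*-cong (omit3-∤ f 3∤j) (omit3-∤ f 3∤N∸j)) (omit3-∤ f 3∤N+j))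
               (S.trans eq (S.+-congʳ {const (3 * N) ⊛ q} (S.sym (S.*-cong (S.*-cong G≗g G≗g) G≗g))))
      where
      f = X+ ∘ node (3 * N)
      G≗g = omit3-∤ (X+ ∘ node N) 3∤j
      3∤N∸j : ¬ 3 ∣ N ∸ suc j
      3∤N∸j 3∣ = 3∤j (∣m+n∣m⇒∣n (subst (3 ∣_) (trans (sym (m+[n∸m]≡n (M≤N j<M))) (+-comm (suc j) _)) 3∣N) 3∣)
      3∤N+j : ¬ 3 ∣ N + suc j
      3∤N+j 3∣ = 3∤j (∣m+n∣m⇒∣n 3∣ 3∣N)

-- The power (z + 2)^k. The constant 2 is `node 3 1`, the single node occurring in `U 0`.
binomial : ℕ → Series
binomial = ∏ (λ _ → X+ 2)

binomial-3* : ∀ k → binomial (3 * k) ≗ binomial k ⊛ binomial k ⊛ binomial k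
binomial-3* k = begin
  binomial (k + (k + (k + 0)))
    ≈⟨ ∏-+ _ k (k + (k + 0)) ⟩
  binomial k ⊛ binomial (k + (k + 0))
    ≈⟨ S.*-congˡ {binomial k} (∏-+ _ k (k + 0)) ⟩
  binomial k ⊛ (binomial k ⊛ binomial (k + 0))
    ≈⟨ S.*-assoc (binomial k) (binomial k) (binomial (k + 0)) ⟨
  binomial k ⊛ binomial k ⊛ binomial (k + 0)
    ≈⟨ S.*-congˡ {binomial k ⊛ binomial k} (S.reflexive (cong binomial (+-identityʳ k))) ⟩
  binomial k ⊛ binomial k ⊛ binomial k ∎
  where open ≗-Reasoning

-- Cubing the congruence raises its modulus from 3ⁿ⁺¹ to 3ⁿ⁺², which is exactly the precision of
-- `U-suc`.
U≋binomial : ∀ n → U n ≋ binomial (3 ^ n) [mod const (3 ^ suc n) ]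
U≋binomial zero = (λ _ → 0) , S.trans (S.*-congˡ {const 1} (omit3-∤ (X+ ∘ node 3) 3∤1))
  (S.trans (S.sym (S.+-identityʳ (binomial 1))) (S.+-congˡ {binomial 1} (S.sym (S.zeroʳ (const 3)))))
  where
  3∤1 : ¬ 3 ∣ 1
  3∤1 3∣1 with ∣⇒≤ 3∣1
  ... | s≤s ()
U≋binomial (suc n) =
  let p , P = U-suc n
      q , Q = cube-mod {const (3 ^ suc n)} {const (3 ^ n)} (S.sym (const-3 (3 ^ n))) (U≋binomial n)
      m = const (3 ^ suc (suc n))
      b = binomial (3 ^ n)
  in q ⊕ p , (begin
    U (suc n)                     ≈⟨ P ⟩
    U n ⊛ U n ⊛ U n ⊕ m ⊛ p       ≈⟨ S.+-congʳ {m ⊛ p} Q ⟩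
    b ⊛ b ⊛ b ⊕ (const 1 ⊕ const 1 ⊕ const 1) ⊛ const (3 ^ suc n) ⊛ q ⊕ m ⊛ p
      ≈⟨ S.+-congʳ {m ⊛ p} (S.+-cong (S.sym (binomial-3* (3 ^ n))) (S.*-congʳ {q} (const-3 (3 ^ suc n)))) ⟩
    binomial (3 ^ suc n) ⊕ m ⊛ q ⊕ m ⊛ p
      ≈⟨ S.+-assoc (binomial (3 ^ suc n)) (m ⊛ q) (m ⊛ p) ⟩
    binomial (3 ^ suc n) ⊕ (m ⊛ q ⊕ m ⊛ p)
      ≈⟨ S.+-congˡ {binomial (3 ^ suc n)} (S.distribˡ m q p) ⟨
    binomial (3 ^ suc n) ⊕ m ⊛ (q ⊕ p) ∎)
  where open ≗-Reasoning

-- Expansion in powers of x² + N x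

quadratic : ℕ → Series
quadratic N = X ⊛ X+ N

-- Substitution of q for z in ∏ (z + a j), expressed through coefficients so that no composition of
-- series has to be defined.
∏-quadratic : ∀ q (a : ℕ → ℕ) k →
  ∏ (λ j → q ⊕ const (a j)) k ≗ ∑ (λ m → const (∏ (X+ ∘ a) k m) ⊛ ∏ (λ _ → q) m) (suc k)
∏-quadratic q a zero = λ i → sym (trans (⊛-comm (const 1) (const 1) i) (S.*-identityʳ (const 1) i))
∏-quadratic q a (suc k) = begin
  ∏ (λ j → q ⊕ const (a j)) k ⊛ (q ⊕ c)
    ≈⟨ S.*-congʳ {q ⊕ c} (∏-quadratic q a k) ⟩
  ∑ (λ m → t m ⊛ p m) (suc k) ⊛ (q ⊕ c)
    ≈⟨ ∑-distribʳ-* (λ m → t m ⊛ p m) (q ⊕ c) (suc k) ⟩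
  ∑ (λ m → t m ⊛ p m ⊛ (q ⊕ c)) (suc k)
    ≈⟨ ∑-cong (suc k) (λ m → S.trans (S.distribˡ (t m ⊛ p m) q c) (S.+-congʳ {t m ⊛ p m ⊛ c} (S.*-assoc (t m) (p m) q))) ⟩
  ∑ (λ m → t m ⊛ p (suc m) ⊕ t m ⊛ p m ⊛ c) (suc k)
    ≈⟨ ∑-distrib-+ (λ m → t m ⊛ p (suc m)) (λ m → t m ⊛ p m ⊛ c) (suc k) ⟩
  ∑ (λ m → t m ⊛ p (suc m)) (suc k) ⊕ ∑ (λ m → t m ⊛ p m ⊛ c) (suc k)
    -- The term with m = k + 1 vanishes by degree. Once it is appended, splitting off the head
    -- leaves two sums over the same powers of q.
    ≈⟨ S.+-congˡ {s₁} (S.trans (S.+-congˡ {s₂} top≗0) (S.+-identityʳ s₂)) ⟨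
  ∑ (λ m → t m ⊛ p (suc m)) (suc k) ⊕ ∑ (λ m → t m ⊛ p m ⊛ c) (suc (suc k))
    ≈⟨ S.+-congˡ {s₁} (∑-head (λ m → t m ⊛ p m ⊛ c) (suc k)) ⟩
  ∑ (λ m → t m ⊛ p (suc m)) (suc k) ⊕ (t 0 ⊛ p 0 ⊛ c ⊕ ∑ (λ m → t (suc m) ⊛ p (suc m) ⊛ c) (suc k))
    ≈⟨ S.trans (exchange s₁ (t 0 ⊛ p 0 ⊛ c) s₃)
         (S.+-congˡ {t 0 ⊛ p 0 ⊛ c} (S.sym (∑-distrib-+ (λ m → t m ⊛ p (suc m)) (λ m → t (suc m) ⊛ p (suc m) ⊛ c) (suc k)))) ⟩
  t 0 ⊛ p 0 ⊛ c ⊕ ∑ (λ m → t m ⊛ p (suc m) ⊕ t (suc m) ⊛ p (suc m) ⊛ c) (suc k)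
    ≈⟨ S.+-cong t′-zero (∑-cong (suc k) t′-suc) ⟨
  t′ 0 ⊛ p 0 ⊕ ∑ (λ m → t′ (suc m) ⊛ p (suc m)) (suc k)
    ≈⟨ ∑-head (λ m → t′ m ⊛ p m) (suc k) ⟨
  ∑ (λ m → t′ m ⊛ p m) (suc (suc k)) ∎
  where
  open ≗-Reasoning
  c = const (a k)
  p = ∏ (λ _ → q)
  t t′ : ℕ → Series
  t m = const (∏ (X+ ∘ a) k m)
  t′ m = const (∏ (X+ ∘ a) (suc k) m)
  s₁ = ∑ (λ m → t m ⊛ p (suc m)) (suc k)
  s₂ = ∑ (λ m → t m ⊛ p m ⊛ c) (suc k)
  s₃ = ∑ (λ m → t (suc m) ⊛ p (suc m) ⊛ c) (suc k)

  exchange : ∀ x y z → x ⊕ (y ⊕ z) ≗ y ⊕ (x ⊕ z)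
  exchange x y z i = +-exchange (x i) (y i) (z i)
    where
    +-exchange : ∀ x y z → x + (y + z) ≡ y + (x + z)
    +-exchange = solve-∀

  top≗0 : t (suc k) ⊛ p (suc k) ⊛ c ≗ λ _ → 0
  top≗0 = S.trans (S.*-congʳ {c} (S.trans (S.*-congʳ {p (suc k)} t≗0) (⊛-zeroˡ (p (suc k))))) (⊛-zeroˡ c)
    where
    t≗0 : t (suc k) ≗ λ _ → 0
    t≗0 zero    = ∏-X+-> a k (n<1+n k)
    t≗0 (suc _) = refl

  swap : ∀ x y z → x ⊛ y ⊛ z ≗ x ⊛ z ⊛ y
  swap x y z = S.trans (⊛-assoc x y z) (S.trans (S.*-congˡ {x} (⊛-comm y z)) (S.sym (⊛-assoc x z y)))

  t′-zero : t′ 0 ⊛ p 0 ≗ t 0 ⊛ p 0 ⊛ c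
  t′-zero = S.trans (S.*-congʳ {p 0} (const-* (∏ (X+ ∘ a) k 0) (a k))) (swap (t 0) c (p 0))

  t′-suc : ∀ m → t′ (suc m) ⊛ p (suc m) ≗ t m ⊛ p (suc m) ⊕ t (suc m) ⊛ p (suc m) ⊛ c
  t′-suc m = begin
    t′ (suc m) ⊛ p (suc m)
      ≈⟨ S.*-congʳ {p (suc m)} (S.reflexive (cong const (∏-X+-suc a k m))) ⟩
    const (∏ (X+ ∘ a) k m + a k * ∏ (X+ ∘ a) k (suc m)) ⊛ p (suc m)
      ≈⟨ S.*-congʳ {p (suc m)} (S.trans (const-+ (∏ (X+ ∘ a) k m) _)
           (S.+-congˡ {t m} (S.trans (const-* (a k) _) (⊛-comm c (t (suc m)))))) ⟩
    (t m ⊕ t (suc m) ⊛ c) ⊛ p (suc m)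
      ≈⟨ S.distribʳ (p (suc m)) (t m) (t (suc m) ⊛ c) ⟩
    t m ⊛ p (suc m) ⊕ t (suc m) ⊛ c ⊛ p (suc m)
      ≈⟨ S.+-congˡ {t m ⊛ p (suc m)} (swap (t (suc m)) c (p (suc m))) ⟩
    t m ⊛ p (suc m) ⊕ t (suc m) ⊛ p (suc m) ⊛ c ∎

-- 3-adic valuations

-- A relational form that is easy to multiply and perturb, unlike the recursion in `v3`; it forces x
-- to be nonzero.
record Valuation (x e : ℕ) : Set where
  constructor valuation
  field
    unit   : ℕ
    x≡     : x ≡ 3 ^ e * unit
    3∤unit : ¬ 3 ∣ unit

3-prime : Prime 3
3-prime = from-yes (prime? 3)

3^-mono-∣ : ∀ {d e} → d ≤ e → 3 ^ d ∣ 3 ^ e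
3^-mono-∣ {d} {e} d≤e = subst (3 ^ d ∣_)
  (trans (sym (^-distribˡ-+-* 3 d (e ∸ d))) (cong (3 ^_) (m+[n∸m]≡n d≤e))) (m∣m*n (3 ^ (e ∸ d)))

3^∣* : ∀ {a b c x y} → 3 ^ a ∣ x → 3 ^ b ∣ y → c ≤ a + b → 3 ^ c ∣ x * y
3^∣* {a} {b} a∣x b∣y c≤a+b =
  ∣-trans (3^-mono-∣ c≤a+b) (subst (_∣ _) (sym (^-distribˡ-+-* 3 a b)) (*-pres-∣ a∣x b∣y))

valuation-∣ : ∀ {x e} → Valuation x e → 3 ^ e ∣ x
valuation-∣ {e = e} (valuation u refl _) = m∣m*n u

valuation-* : ∀ {x y e f} → Valuation x e → Valuation y f → Valuation (x * y) (e + f)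
valuation-* {e = e} {f} (valuation u refl 3∤u) (valuation w refl 3∤w) = valuation (u * w)
  (trans (rearrange (3 ^ e) u (3 ^ f) w) (cong (_* (u * w)) (sym (^-distribˡ-+-* 3 e f)))) 3∤uw
  where
  rearrange : ∀ a u b w → a * u * (b * w) ≡ a * b * (u * w)
  rearrange = solve-∀
  3∤uw : ¬ 3 ∣ u * w
  3∤uw 3∣uw with euclidsLemma u w 3-prime 3∣uw
  ... | inj₁ 3∣u = 3∤u 3∣u
  ... | inj₂ 3∣w = 3∤w 3∣w

-- For y only divisibility is asked, because it will be 0 or a sum whose exact valuation is unknown.
valuation-+ : ∀ {x y e} → Valuation x e → 3 ^ suc e ∣ y → Valuation (x + y) e
valuation-+ {e = e} (valuation u refl 3∤u) (divides q refl) =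
  valuation (u + 3 * q) (rearrange (3 ^ e) u q)
    λ 3∣ → 3∤u (∣m+n∣m⇒∣n (subst (3 ∣_) (+-comm u (3 * q)) 3∣) (m∣m*n q))
  where
  rearrange : ∀ a u q → a * u + q * (3 * a) ≡ a * (u + 3 * q)
  rearrange = solve-∀

valuation-max : ∀ {x d e} → Valuation x e → 3 ^ d ∣ x → d ≤ e
valuation-max {d = d} {e} (valuation u refl 3∤u) d∣x = ≮⇒≥ λ e<d →
  3∤u (*-cancelˡ-∣ (3 ^ e) {{m^n≢0 3 e}}
    (subst (_∣ 3 ^ e * u) (*-comm 3 (3 ^ e)) (∣-trans (3^-mono-∣ e<d) d∣x)))

valuation-unique : ∀ {x d e} → Valuation x d → Valuation x e → d ≡ e
valuation-unique v w = ≤-antisym (valuation-max w (valuation-∣ v)) (valuation-max v (valuation-∣ w))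

valuation-≢0 : ∀ {x e} → Valuation x e → x ≢ 0
valuation-≢0 {e = e} v refl = 1+n≰n (valuation-max v ((3 ^ suc e) ∣0))

∤⇒valuation : ∀ {x} → ¬ 3 ∣ x → Valuation x 0
∤⇒valuation {x} 3∤x = valuation x (sym (+-identityʳ x)) 3∤x

valuation⇒∤ : ∀ {x} → Valuation x 0 → ¬ 3 ∣ x
valuation⇒∤ v 3∣x = 1+n≰n (valuation-max {d = 1} v 3∣x)

valuation-3^ : ∀ n → Valuation (3 ^ n) n
valuation-3^ n = valuation 1 (sym (*-identityʳ _)) λ 3∣1 → contradiction (∣⇒≤ 3∣1) λ { (s≤s ()) }

v3-aux-valuation : ∀ fuel x → x ≤ fuel → x ≢ 0 → Valuation x (v3-aux fuel x)
v3-aux-valuation zero .0 z≤n x≢0 = contradiction refl x≢0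
v3-aux-valuation (suc fuel) x x≤ x≢0 with x ≟ 0
... | yes x≡0 = contradiction x≡0 x≢0
... | no _ with x % 3 ≟ 0
...   | no x%3≢0 = ∤⇒valuation λ 3∣x → x%3≢0 (n∣m⇒m%n≡0 x 3 3∣x)
...   | yes x%3≡0 =
  let valuation u eq 3∤u = v3-aux-valuation fuel (x / 3)
        (≤-pred (≤-trans (m/n<m x 3 {{≢-nonZero x≢0}} (s≤s (s≤s z≤n))) x≤)) x/3≢0
  in valuation u (trans x≡3[x/3] (trans (cong (3 *_) eq) (sym (*-assoc 3 (3 ^ v3-aux fuel (x / 3)) u)))) 3∤u
  where
  x≡3[x/3] : x ≡ 3 * (x / 3)
  x≡3[x/3] = trans (m≡m%n+[m/n]*n x 3) (trans (cong (_+ x / 3 * 3) x%3≡0) (*-comm (x / 3) 3))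
  x/3≢0 : x / 3 ≢ 0
  x/3≢0 eq = x≢0 (trans x≡3[x/3] (cong (3 *_) eq))

v3-valuation : ∀ {x} → x ≢ 0 → Valuation x (v3 x)
v3-valuation {x} = v3-aux-valuation x x ≤-refl

valuation⇒v3 : ∀ {x e} → Valuation x e → v3 x ≡ e
valuation⇒v3 v = valuation-unique (v3-valuation (valuation-≢0 v)) v

v3-< : ∀ {n i} → 0 < i → i < 3 ^ n → v3 i < n
v3-< {n} {i@(suc _)} _ i<3^n = ≰⇒> λ n≤v → <⇒≱ i<3^n
  (∣⇒≤ (∣-trans (3^-mono-∣ n≤v) (valuation-∣ (v3-valuation {i} λ ()))))

v3-+ : ∀ {x y} → 0 < x → 0 < y → v3 x < v3 y → v3 (x + y) ≡ v3 x
v3-+ {x@(suc _)} {y@(suc _)} _ _ vx<vy = valuation⇒v3 (valuation-+ (v3-valuation {x} λ ())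
  (∣-trans (3^-mono-∣ vx<vy) (valuation-∣ (v3-valuation {y} λ ()))))

v3-3^ : ∀ n → v3 (3 ^ n) ≡ n
v3-3^ n = valuation⇒v3 (valuation-3^ n)

-- Convolutions and sums with one dominant term

⊛-∣ : ∀ d f g k → (∀ i j → i + j ≡ k → d ∣ f i * g j) → d ∣ (f ⊛ g) k
⊛-∣ d f g zero    d∣ = d∣ 0 0 refl
⊛-∣ d f g (suc k) d∣ = ∣m∣n⇒∣m+n (d∣ 0 (suc k) refl) (⊛-∣ d (f ∘ suc) g k λ i j eq → d∣ (suc i) j (cong suc eq))

⊛-dominated : ∀ {e} f g i j → Valuation (f i * g j) e →
              (∀ i′ j′ → i′ + j′ ≡ i + j → i′ ≢ i → 3 ^ suc e ∣ f i′ * g j′) →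
              Valuation ((f ⊛ g) (i + j)) e
⊛-dominated f g zero    zero    v _  = v
⊛-dominated {e} f g zero    (suc j) v d∣ = valuation-+ v
  (⊛-∣ (3 ^ suc e) (f ∘ suc) g j λ i′ j′ eq → d∣ (suc i′) j′ (cong suc eq) λ ())
⊛-dominated {e} f g (suc i) j v d∣ = subst (λ x → Valuation x e) (+-comm _ (f 0 * g (suc (i + j))))
  (valuation-+ (⊛-dominated (f ∘ suc) g i j v λ i′ j′ eq i′≢i → d∣ (suc i′) j′ (cong suc eq) (i′≢i ∘ suc-injective))
    (d∣ 0 (suc (i + j)) refl λ ()))

∑-∣ : ∀ d F i k → (∀ m → m < k → d ∣ F m i) → d ∣ ∑ F k i
∑-∣ d F i zero    d∣ = d ∣0
∑-∣ d F i (suc k) d∣ = ∣m∣n⇒∣m+n (∑-∣ d F i k λ m m<k → d∣ m (m<n⇒m<1+n m<k)) (d∣ k ≤-refl)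

∑-dominated : ∀ {e} F i l k → l < k → Valuation (F l i) e →
              (∀ m → m < k → m ≢ l → 3 ^ suc e ∣ F m i) → Valuation (∑ F k i) e
∑-dominated {e} F i l (suc k) l<1+k v d∣ with k ≟ l
... | yes refl = subst (λ x → Valuation x e) (+-comm (F l i) _)
      (valuation-+ v (∑-∣ (3 ^ suc e) F i l λ m m<l → d∣ m (m<n⇒m<1+n m<l) (<⇒≢ m<l)))
... | no k≢l = valuation-+
      (∑-dominated F i l k (≤∧≢⇒< (≤-pred l<1+k) (≢-sym k≢l)) v λ m m<k → d∣ m (m<n⇒m<1+n m<k))
      (d∣ k ≤-refl k≢l)

-- Valuations of the coefficients of (z + 2)^(3ⁿ) and of U

binomial-suc : ∀ k i → binomial (suc k) (suc i) ≡ binomial k i + 2 * binomial k (suc i)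
binomial-suc = ∏-X+-suc (λ _ → 2)

-- These are the coefficients of the derivative of (z + 2)^(k + 1); the proof goes through Pascal's
-- rule.
binomial-absorption : ∀ k i → suc i * binomial (suc k) (suc i) ≡ suc k * binomial k i
binomial-absorption zero zero = refl
binomial-absorption zero (suc i) rewrite binomial-suc 0 (suc i) = *-zeroʳ (suc (suc i))
binomial-absorption (suc k) zero = begin
  1 * binomial (2 + k) 1 ≡⟨ cong (1 *_) (binomial-suc (suc k) 0) ⟩
  1 * (binomial k 0 * 2 + 2 * binomial (suc k) 1) ≡⟨ rearrange₁ (binomial k 0) (binomial (suc k) 1) ⟩
  binomial k 0 * 2 + 2 * (1 * binomial (suc k) 1) ≡⟨ cong (λ x → binomial k 0 * 2 + 2 * x) (binomial-absorption k 0) ⟩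
  binomial k 0 * 2 + 2 * (suc k * binomial k 0) ≡⟨ rearrange₂ (binomial k 0) k ⟩
  suc (suc k) * (binomial k 0 * 2) ∎
  where
  open ≡-Reasoning
  rearrange₁ : ∀ a b → 1 * (a * 2 + 2 * b) ≡ a * 2 + 2 * (1 * b)
  rearrange₁ = solve-∀
  rearrange₂ : ∀ a k → a * 2 + 2 * (suc k * a) ≡ suc (suc k) * (a * 2)
  rearrange₂ = solve-∀
binomial-absorption (suc k) (suc i) = begin
  (2 + i) * binomial (2 + k) (2 + i) ≡⟨ cong ((2 + i) *_) (binomial-suc (suc k) (suc i)) ⟩
  (2 + i) * (b + 2 * binomial (suc k) (2 + i)) ≡⟨ rearrange₁ i b (binomial (suc k) (2 + i)) ⟩
  b + suc i * b + 2 * ((2 + i) * binomial (suc k) (2 + i))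
    ≡⟨ cong₂ (λ x y → b + x + 2 * y) (binomial-absorption k i) (binomial-absorption k (suc i)) ⟩
  b + suc k * binomial k i + 2 * (suc k * binomial k (suc i)) ≡⟨ rearrange₂ b k (binomial k i) (binomial k (suc i)) ⟩
  b + suc k * (binomial k i + 2 * binomial k (suc i)) ≡⟨ cong (λ x → b + suc k * x) (binomial-suc k i) ⟨
  (2 + k) * b ∎
  where
  open ≡-Reasoning
  b = binomial (suc k) (suc i)
  rearrange₁ : ∀ i b c → (2 + i) * (b + 2 * c) ≡ b + suc i * b + 2 * ((2 + i) * c)
  rearrange₁ = solve-∀
  rearrange₂ : ∀ b k x y → b + suc k * x + 2 * (suc k * y) ≡ b + suc k * (x + 2 * y)
  rearrange₂ = solve-∀

3∤binomial-zero : ∀ k → ¬ 3 ∣ binomial k 0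
3∤binomial-zero zero    = valuation⇒∤ (valuation-3^ 0)
3∤binomial-zero (suc k) 3∣ with euclidsLemma (binomial k 0) 2 3-prime 3∣
... | inj₁ 3∣b = 3∤binomial-zero k 3∣b
... | inj₂ 3∣2 = contradiction (∣⇒≤ 3∣2) λ { (s≤s (s≤s ())) }

module _ {n k : ℕ} (3^n≡ : 3 ^ n ≡ suc k) where

  -- Absorption makes 3ⁿ divide (i + 1) times the coefficient, whereas v₃(i + 1) < n.
  3∣binomial : ∀ i → i < k → 3 ∣ binomial (suc k) (suc i)
  3∣binomial i i<k with 3 ∣? binomial (suc k) (suc i)
  ... | yes 3∣ = 3∣
  ... | no 3∤  = contradiction
    (valuation-max (valuation-* (v3-valuation {suc i} λ ()) (∤⇒valuation 3∤))
      (subst (3 ^ n ∣_) (sym (binomial-absorption k i)) (subst (λ x → 3 ^ n ∣ x * binomial k i) 3^n≡ (m∣m*n _))))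
    (<⇒≱ (subst (_< n) (sym (+-identityʳ _)) (v3-< {n} (s≤s z≤n) (subst (suc i <_) (sym 3^n≡) (s≤s i<k)))))

  -- By Pascal's rule and `3∣binomial`, b + 2 b′ is a multiple of 3 for consecutive coefficients b,
  -- b′ of (z + 2)^k. Divisibility would therefore descend to the constant coefficient, a power of
  -- 2.
  3∤binomial-pred : ∀ i → i ≤ k → ¬ 3 ∣ binomial k i
  3∤binomial-pred zero    _   = 3∤binomial-zero k
  3∤binomial-pred (suc i) i<k 3∣ = 3∤binomial-pred i (<⇒≤ i<k)
    (∣m+n∣m⇒∣n (subst (3 ∣_) (trans (binomial-suc k i) (+-comm (binomial k i) _)) (3∣binomial i i<k)) (∣n⇒∣m*n 2 3∣))

  -- The right side of the absorption identity is 3ⁿ times a number prime to 3, so the valuations of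
  -- the two factors on the left add up to n.
  binomial-valuation-suc : ∀ i → i ≤ k → Valuation (binomial (suc k) (suc i)) (n ∸ v3 (suc i))
  binomial-valuation-suc i i≤k = subst (Valuation b) (trans (sym (m+n∸m≡n (v3 (suc i)) (v3 b))) (cong (_∸ v3 (suc i)) sum≡n)) vb
    where
    b = binomial (suc k) (suc i)
    product : Valuation (suc i * b) n
    product = subst (λ x → Valuation x n)
      (trans (cong (_* binomial k i) 3^n≡) (sym (binomial-absorption k i)))
      (subst (Valuation (3 ^ n * binomial k i)) (+-identityʳ n) (valuation-* (valuation-3^ n) (∤⇒valuation (3∤binomial-pred i i≤k))))
    vb : Valuation b (v3 b)
    vb = v3-valuation λ b≡0 → valuation-≢0 product (trans (cong (suc i *_) b≡0) (*-zeroʳ (suc i)))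
    sum≡n : v3 (suc i) + v3 b ≡ n
    sum≡n = valuation-unique (valuation-* (v3-valuation {suc i} λ ()) vb) product

binomial-valuation : ∀ n {i} → 0 < i → i ≤ 3 ^ n → Valuation (binomial (3 ^ n) i) (n ∸ v3 i)
binomial-valuation n {suc i} _ i<3^n = subst (λ k → Valuation (binomial k (suc i)) (n ∸ v3 (suc i))) (sym 3^n≡)
  (binomial-valuation-suc {n} 3^n≡ i (≤-pred (subst (suc i ≤_) 3^n≡ i<3^n)))
  where
  3^n≡ = 3^≡1+2half n

U-coefficient : ∀ n i → ∃ λ q → U n i ≡ binomial (3 ^ n) i + 3 ^ suc n * q
U-coefficient n i = let q , eq = U≋binomial n in
  q i , trans (eq i) (cong (binomial (3 ^ n) i +_) (const-⊛ (3 ^ suc n) q i))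

U-valuation : ∀ n {i} → 0 < i → i ≤ 3 ^ n → Valuation (U n i) (n ∸ v3 i)
U-valuation n {i} 0<i i≤ = let q , eq = U-coefficient n i in
  subst (λ x → Valuation x (n ∸ v3 i)) (sym eq)
    (valuation-+ (binomial-valuation n 0<i i≤) (∣-trans (3^-mono-∣ (s≤s (m∸n≤m n (v3 i)))) (m∣m*n q)))

U-valuation-0 : ∀ n → Valuation (U n 0) 0
U-valuation-0 n = let q , eq = U-coefficient n 0 in
  subst (λ x → Valuation x 0) (sym eq)
    (valuation-+ (∤⇒valuation (3∤binomial-zero (3 ^ n))) (∣-trans (3^-mono-∣ {1} {suc n} (s≤s z≤n)) (m∣m*n q)))

-- These coefficients are in fact 0 by degree, but the congruence yields divisibility directly and
-- that suffices for comparing valuations.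
U-∣-beyond : ∀ n {i} → 3 ^ n < i → 3 ^ suc n ∣ U n i
U-∣-beyond n {i} 3^n<i = let q , eq = U-coefficient n i in
  subst (3 ^ suc n ∣_) (sym (trans eq (cong (_+ 3 ^ suc n * q) (∏-X+-> (λ _ → 2) (3 ^ n) 3^n<i)))) (m∣m*n q)

-- The valuations of the coefficients of T

-- Each clause is the valuation of the dominant product in coefficient l of `T (suc n)`. Up to
-- `half n` it is the constant coefficient of `U n`, prime to 3, times 9^(half n - l) times
-- coefficient l of `T n`. Beyond, it is coefficient l - half n of `U n` times the leading
-- coefficient 1 of the rescaled factor.
V : ℕ → ℕ → ℕ
V zero    l = 0
V (suc n) l with l ≤? half n
... | yes _ = 2 * (half n ∸ l) + V n l
... | no _  = n ∸ v3 (l ∸ half n)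

V-low : ∀ n l d → l + d ≡ half n → V (suc n) l ≡ 2 * d + V n l
V-low n l d l+d≡ with l ≤? half n
... | yes _ = cong (λ x → 2 * x + V n l) (trans (cong (_∸ l) (sym l+d≡)) (m+n∸m≡n l d))
... | no l≰ = contradiction (subst (l ≤_) l+d≡ (m≤m+n l d)) l≰

V-high : ∀ n {r} → 0 < r → V (suc n) (half n + r) ≡ n ∸ v3 r
V-high n {r} 0<r with half n + r ≤? half n
... | yes ≤h = contradiction ≤h (<⇒≱ (m<m+n (half n) 0<r))
... | no _  = cong (λ x → n ∸ v3 x) (m+n∸m≡n (half n) r)

V-half : ∀ n → V n (half n) ≡ 0
V-half zero    = refl
V-half (suc n) = begin
  V (suc n) (half (suc n))    ≡⟨ cong (V (suc n)) (half-suc n) ⟩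
  V (suc n) (half n + 3 ^ n)  ≡⟨ V-high n (m^n>0 3 n) ⟩
  n ∸ v3 (3 ^ n)              ≡⟨ cong (n ∸_) (v3-3^ n) ⟩
  n ∸ n                       ≡⟨ n∸n≡0 n ⟩
  0                           ∎
  where open ≡-Reasoning

data Position (h l : ℕ) : Set where
  low  : ∀ d → l + d ≡ h → Position h l
  high : ∀ r → 0 < r → h + r ≡ l → Position h l

position : ∀ h l → Position h l
position h l with ≤-<-connex l h
... | inj₁ l≤h = low (h ∸ l) (m+[n∸m]≡n l≤h)
... | inj₂ h<l = high (l ∸ h) (m<n⇒0<n∸m h<l) (m+[n∸m]≡n (<⇒≤ h<l))

V-high-≤ : ∀ n {l} → half n < l → V (suc n) l ≤ n
V-high-≤ n {l} h<l with l ≤? half n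
... | yes l≤h = contradiction l≤h (<⇒≱ h<l)
... | no _    = m∸n≤m n (v3 (l ∸ half n))

n<3^n : ∀ n → n < 3 ^ n
n<3^n zero    = s≤s z≤n
n<3^n (suc n) = begin-strict
  suc n         ≤⟨ n<3^n n ⟩
  3 ^ n         <⟨ m<m+n (3 ^ n) (m^n>0 3 n) ⟩
  3 ^ n + 3 ^ n ≤⟨ +-monoʳ-≤ (3 ^ n) (m≤m+n (3 ^ n) _) ⟩
  3 ^ suc n     ∎
  where open ≤-Reasoning

half<3^ : ∀ n → half n < 3 ^ n
half<3^ n = subst (half n <_) (sym (3^≡1+2half n)) (s≤s (m≤m+n (half n) (half n)))

v3-≤-self : ∀ {d} → 0 < d → v3 d ≤ d
v3-≤-self {d@(suc _)} _ =
  ≤-trans (<⇒≤ (n<3^n (v3 d))) (∣⇒≤ (valuation-∣ (v3-valuation {d} λ ())))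

-- Moving degree d from the rescaled factor to U costs 2 d from the powers of 9 and n - v₃(d) from
-- U; this must outweigh any decrease of V. In the induction, an index i + d past the previous half
-- has V below the new n, and v₃(d) ≤ d is covered by 2 d.
V-shift-< : ∀ n i d → 0 < d → i + d ≤ half n → V n (i + d) < 2 * d + (n ∸ v3 d) + V n i
V-shift-< zero i d 0<d i+d≤0 = contradiction (≤-trans (m≤n+m d i) i+d≤0) (<⇒≱ 0<d)
V-shift-< (suc n) i d 0<d i+d≤ with position (half n) (i + d)
... | low e i+d+e≡h = begin-strict
  V (suc n) (i + d) ≡⟨ V-low n (i + d) e i+d+e≡h ⟩
  2 * e + V n (i + d)
    <⟨ +-monoʳ-< (2 * e) (V-shift-< n i d 0<d (subst (i + d ≤_) i+d+e≡h (m≤m+n (i + d) e))) ⟩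
  2 * e + (2 * d + (n ∸ v3 d) + V n i)
    ≤⟨ +-monoʳ-≤ (2 * e) (+-monoˡ-≤ (V n i) (+-mono-≤ (m≤m+n (2 * d) (2 * d)) (∸-monoˡ-≤ (v3 d) (n≤1+n n)))) ⟩
  2 * e + (2 * d + 2 * d + (suc n ∸ v3 d) + V n i)
    ≡⟨ rearrange e d (suc n ∸ v3 d) (V n i) ⟩
  2 * d + (suc n ∸ v3 d) + (2 * (d + e) + V n i)
    ≡⟨ cong (2 * d + (suc n ∸ v3 d) +_) (V-low n i (d + e) (trans (sym (+-assoc i d e)) i+d+e≡h)) ⟨
  2 * d + (suc n ∸ v3 d) + V (suc n) i ∎
  where
  open ≤-Reasoning
  rearrange : ∀ e d x y → 2 * e + (2 * d + 2 * d + x + y) ≡ 2 * d + x + (2 * (d + e) + y)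
  rearrange = solve-∀
... | high r 0<r h+r≡ = begin-strict
  V (suc n) (i + d)              ≤⟨ V-high-≤ n (subst (half n <_) h+r≡ (m<m+n (half n) 0<r)) ⟩
  n                              <⟨ n<1+n n ⟩
  suc n                          ≤⟨ m≤n+m∸n (suc n) (v3 d) ⟩
  v3 d + (suc n ∸ v3 d)          ≤⟨ +-monoˡ-≤ _ (≤-trans (v3-≤-self 0<d) (m≤m+n d _)) ⟩
  2 * d + (suc n ∸ v3 d)         ≤⟨ m≤m+n _ _ ⟩
  2 * d + (suc n ∸ v3 d) + V (suc n) i ∎
  where open ≤-Reasoning

-- For competitors of the top coefficient of the rescaled factor. Either i is at most the previous
-- half and d is at least a full power of 3, or d and the excess r of i add up to that power, which
-- ties v₃(r) to v₃(d).
V-below-half : ∀ n i d → 0 < d → i + d ≡ half n → n < 2 * d + v3 d + V n i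
V-below-half zero i d 0<d i+d≡0 = contradiction (subst (d ≤_) i+d≡0 (m≤n+m d i)) (<⇒≱ 0<d)
V-below-half (suc n) i d 0<d i+d≡ with position (half n) i
... | low e i+e≡h = begin-strict
  suc n                 ≤⟨ n<3^n n ⟩
  3 ^ n                 ≤⟨ m≤n+m (3 ^ n) e ⟩
  e + 3 ^ n             ≡⟨ d≡ ⟨
  d                     <⟨ m<m+n d (subst (0 <_) (sym (+-identityʳ d)) 0<d) ⟩
  2 * d                 ≤⟨ m≤m+n (2 * d) (v3 d) ⟩
  2 * d + v3 d          ≤⟨ m≤m+n _ _ ⟩
  2 * d + v3 d + V (suc n) i ∎
  where
  open ≤-Reasoning
  d≡ : d ≡ e + 3 ^ n
  d≡ = +-cancelˡ-≡ i _ _ (trans i+d≡ (trans (half-suc n) (trans (cong (_+ 3 ^ n) (sym i+e≡h)) (+-assoc i e (3 ^ n)))))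
... | high r 0<r refl = begin-strict
  suc n                       ≤⟨ s≤s (m≤n+m∸n n (v3 r)) ⟩
  suc (v3 r + (n ∸ v3 r))     ≤⟨ s≤s (+-monoˡ-≤ (n ∸ v3 r) v3r≤v3d) ⟩
  suc (v3 d + (n ∸ v3 r))     <⟨ +-monoˡ-≤ (v3 d + (n ∸ v3 r)) (*-monoʳ-≤ 2 0<d) ⟩
  2 * d + (v3 d + (n ∸ v3 r)) ≡⟨ +-assoc (2 * d) (v3 d) _ ⟨
  2 * d + v3 d + (n ∸ v3 r)   ≡⟨ cong (2 * d + v3 d +_) (V-high n 0<r) ⟨
  2 * d + v3 d + V (suc n) (half n + r) ∎
  where
  open ≤-Reasoning
  d+r≡ : d + r ≡ 3 ^ n
  d+r≡ = trans (+-comm d r) (+-cancelˡ-≡ (half n) _ _ (trans (sym (+-assoc (half n) r d)) (trans i+d≡ (half-suc n))))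
  -- If v₃(d) < v₃(r), then v₃(d + r) = v₃(d) < n, although d + r = 3ⁿ.
  v3r≤v3d : v3 r ≤ v3 d
  v3r≤v3d = ≮⇒≥ λ v3d<v3r → <⇒≢ (v3-< {n} 0<d (subst (d <_) d+r≡ (m<m+n d 0<r)))
    (trans (sym (v3-+ 0<d 0<r v3d<v3r)) (trans (cong v3 d+r≡) (v3-3^ n)))

-- For the expansion in powers of x² + N x: the power with exponent l + j brings N^(2 j), of
-- valuation 2 j n. The summand v₃(l) on the left is what even k requires.
V-slope : ∀ n l j → 0 < l → 0 < j → l + j ≤ half n → V n l + v3 l < 2 * (j * n) + V n (l + j)
V-slope zero l j 0<l 0<j l+j≤0 = contradiction (≤-trans (m≤n+m j l) l+j≤0) (<⇒≱ 0<j)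
V-slope (suc n) l j 0<l 0<j l+j≤ with position (half n) l
... | high r 0<r refl = begin-strict
  V (suc n) l + v3 l  ≤⟨ +-mono-≤ (V-high-≤ n (m<m+n (half n) 0<r)) (≤-pred (v3-< {suc n} 0<l (≤-<-trans (≤-trans (m≤m+n l j) l+j≤) (half<3^ (suc n))))) ⟩
  n + n               <⟨ +-mono-< (n<1+n n) (n<1+n n) ⟩
  suc n + suc n       ≡⟨ cong (suc n +_) (+-identityʳ (suc n)) ⟨
  2 * suc n           ≤⟨ *-monoʳ-≤ 2 (m≤n*m (suc n) j {{>-nonZero 0<j}}) ⟩
  2 * (j * suc n)     ≤⟨ m≤m+n _ _ ⟩
  2 * (j * suc n) + V (suc n) (l + j) ∎
  where
  open ≤-Reasoning
... | low e l+e≡h with position (half n) (l + j)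
...   | low e′ l+j+e′≡h = begin-strict
  V (suc n) l + v3 l
    ≡⟨ cong (_+ v3 l) (V-low n l (j + e′) (trans (sym (+-assoc l j e′)) l+j+e′≡h)) ⟩
  2 * (j + e′) + V n l + v3 l                   ≡⟨ +-assoc (2 * (j + e′)) (V n l) (v3 l) ⟩
  2 * (j + e′) + (V n l + v3 l)
    <⟨ +-monoʳ-< (2 * (j + e′)) (V-slope n l j 0<l 0<j (subst (l + j ≤_) l+j+e′≡h (m≤m+n (l + j) e′))) ⟩
  2 * (j + e′) + (2 * (j * n) + V n (l + j))    ≡⟨ rearrange j e′ n (V n (l + j)) ⟩
  2 * (j * suc n) + (2 * e′ + V n (l + j))      ≡⟨ cong (2 * (j * suc n) +_) (V-low n (l + j) e′ l+j+e′≡h) ⟨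
  2 * (j * suc n) + V (suc n) (l + j)           ∎
  where
  open ≤-Reasoning
  rearrange : ∀ j e n x → 2 * (j + e) + (2 * (j * n) + x) ≡ 2 * (j * suc n) + (2 * e + x)
  rearrange = solve-∀
V-slope (suc n) l j 0<l 0<j l+j≤ | low zero l+0≡h | high r 0<r h+r≡ = begin-strict
  V (suc n) l + v3 l    ≡⟨ cong (_+ v3 l) (trans (V-low n l 0 l+0≡h) (trans (cong (V n) l≡h) (V-half n))) ⟩
  v3 l                  <⟨ v3-< {n} 0<l (subst (_< 3 ^ n) (sym l≡h) (half<3^ n)) ⟩
  n                     ≤⟨ n≤1+n n ⟩
  suc n                 ≤⟨ m≤n*m (suc n) j {{>-nonZero 0<j}} ⟩
  j * suc n             ≤⟨ m≤m+n (j * suc n) _ ⟩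
  2 * (j * suc n)       ≤⟨ m≤m+n _ _ ⟩
  2 * (j * suc n) + V (suc n) (l + j) ∎
  where
  open ≤-Reasoning
  l≡h : l ≡ half n
  l≡h = trans (sym (+-identityʳ l)) l+0≡h
-- The induction hypothesis is applied only as far as `half n`, where `V n` vanishes; since e ≤ j,
-- the rest of the shift can only enlarge the right side.
V-slope (suc n) l j 0<l 0<j l+j≤ | low e@(suc _) l+e≡h | high r 0<r h+r≡ = begin-strict
  V (suc n) l + v3 l                  ≡⟨ cong (_+ v3 l) (V-low n l e l+e≡h) ⟩
  2 * e + V n l + v3 l                ≡⟨ +-assoc (2 * e) (V n l) (v3 l) ⟩
  2 * e + (V n l + v3 l)              <⟨ +-monoʳ-< (2 * e) (V-slope n l e 0<l (s≤s z≤n) (≤-reflexive l+e≡h)) ⟩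
  2 * e + (2 * (e * n) + V n (l + e)) ≡⟨ cong (λ x → 2 * e + (2 * (e * n) + x)) (trans (cong (V n) l+e≡h) (V-half n)) ⟩
  2 * e + (2 * (e * n) + 0)           ≡⟨ rearrange e n ⟩
  2 * (e * suc n)                     ≤⟨ *-monoʳ-≤ 2 (*-monoˡ-≤ (suc n) e≤j) ⟩
  2 * (j * suc n)                     ≤⟨ m≤m+n _ _ ⟩
  2 * (j * suc n) + V (suc n) (l + j) ∎
  where
  open ≤-Reasoning
  rearrange : ∀ e n → 2 * e + (2 * (e * n) + 0) ≡ 2 * (e * suc n)
  rearrange = solve-∀
  e≤j : e ≤ j
  e≤j = +-cancelˡ-≤ l e j (subst₂ _≤_ (sym l+e≡h) h+r≡ (m≤m+n (half n) r))

V-zero : ∀ n → 2 * V n 0 + (2 * n + 1) ≡ 3 ^ n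
V-zero zero    = refl
V-zero (suc n) = begin
  2 * V (suc n) 0 + (2 * suc n + 1)                        ≡⟨ cong (λ x → 2 * x + (2 * suc n + 1)) (V-low n 0 (half n) refl) ⟩
  2 * (2 * half n + V n 0) + (2 * suc n + 1)               ≡⟨ rearrange (half n) (V n 0) n ⟩
  (2 * V n 0 + (2 * n + 1)) + 2 * suc (half n + half n)    ≡⟨ cong₂ (λ x y → x + 2 * y) (V-zero n) (sym (3^≡1+2half n)) ⟩
  3 * 3 ^ n                                                ∎
  where
  open ≡-Reasoning
  rearrange : ∀ h v n → 2 * (2 * h + v) + (2 * suc n + 1) ≡ (2 * v + (2 * n + 1)) + 2 * suc (h + h)
  rearrange = solve-∀

half-lower : ∀ k → let n = 3 + k in n + n + suc n ≤ 2 * half n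
half-lower zero    = from-yes (10 ≤? 26)
half-lower (suc k) = begin
  suc n + suc n + suc (suc n)          ≡⟨ rearrange₁ n ⟩
  s + (1 + 2)                          ≤⟨ +-monoʳ-≤ s (+-monoˡ-≤ 2 {1} {2 * s} (s≤s z≤n)) ⟩
  s + (2 * s + 2)                      ≡⟨ +-assoc s (2 * s) 2 ⟨
  3 * s + 2                            ≤⟨ +-monoˡ-≤ 2 (*-monoʳ-≤ 3 (half-lower k)) ⟩
  3 * (2 * half n) + 2                 ≡⟨ rearrange₂ (half n) ⟩
  2 * half (suc n)                     ∎
  where
  open ≤-Reasoning
  n = 3 + k
  s = n + n + suc n
  rearrange₁ : ∀ n → suc n + suc n + suc (suc n) ≡ n + n + suc n + (1 + 2)
  rearrange₁ = solve-∀
  rearrange₂ : ∀ h → 3 * (2 * h) + 2 ≡ 2 * suc (3 * h)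
  rearrange₂ = solve-∀

-- Up to `half n` the recursion adds 2 (half n - l) to V at l but 2 half n at 0, and the surplus 2 l
-- pays for the increase of n by 1. Beyond it, V and v₃ are each at most n, which the exponential
-- `half n` absorbs.
V-max-suc : ∀ n → n + n + suc n ≤ 2 * half n →
            (∀ l → 0 < l → l ≤ half n → V n l + v3 l + n ≤ V n 0) →
            ∀ l → 0 < l → l ≤ half (suc n) → V (suc n) l + v3 l + suc n ≤ V (suc n) 0
V-max-suc n lower ih l 0<l l≤ with position (half n) l
... | low e l+e≡h = begin
  V (suc n) l + v3 l + suc n        ≡⟨ cong (λ x → x + v3 l + suc n) (V-low n l e l+e≡h) ⟩
  2 * e + V n l + v3 l + suc n      ≡⟨ rearrange e (V n l) (v3 l) n ⟩
  2 * e + 1 + (V n l + v3 l + n)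
    ≤⟨ +-mono-≤ (+-monoʳ-≤ (2 * e) (≤-trans 0<l (m≤m+n l (1 * l)))) (ih l 0<l (subst (l ≤_) l+e≡h (m≤m+n l e))) ⟩
  2 * e + 2 * l + V n 0             ≡⟨ cong (_+ V n 0) (trans (+-comm (2 * e) (2 * l)) (sym (*-distribˡ-+ 2 l e))) ⟩
  2 * (l + e) + V n 0               ≡⟨ cong (λ x → 2 * x + V n 0) l+e≡h ⟩
  2 * half n + V n 0                ≡⟨ V-low n 0 (half n) refl ⟨
  V (suc n) 0                       ∎
  where
  open ≤-Reasoning
  rearrange : ∀ e a b n → 2 * e + a + b + suc n ≡ 2 * e + 1 + (a + b + n)
  rearrange = solve-∀
... | high r 0<r refl = begin
  V (suc n) l + v3 l + suc n
    ≤⟨ +-monoˡ-≤ (suc n) (+-mono-≤ (V-high-≤ n (m<m+n (half n) 0<r)) (≤-pred (v3-< {suc n} 0<l (≤-<-trans l≤ (half<3^ (suc n)))))) ⟩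
  n + n + suc n               ≤⟨ lower ⟩
  2 * half n                  ≤⟨ m≤m+n (2 * half n) (V n 0) ⟩
  2 * half n + V n 0          ≡⟨ V-low n 0 (half n) refl ⟨
  V (suc n) 0                 ∎
  where
  open ≤-Reasoning

-- The left side is the valuation for even k = 2 l. The restriction to n at least 3 originates here:
-- for n = 2 and l = 3 the left side is 4, but `V 2 0` is 2. The base case checks all l from 1 to
-- `half 3`, which is 13.
V-max : ∀ k l → let n = 3 + k in 0 < l → l ≤ half n → V n l + v3 l + n ≤ V n 0
V-max zero (suc l) _ l≤ =
  from-yes (allUpTo? (λ l → V 3 (suc l) + v3 (suc l) + 3 ≤? V 3 0) 13) l≤
V-max (suc k) = V-max-suc (3 + k) (half-lower k) (V-max k)

-- The dominant term of U · W

-- With h = half n this is 9^h times Tₙ(z / 9), the rescaling that stays integral and monic.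
W : ℕ → Series
W n = ∏ (λ j → X+ (9 * node (3 ^ n) (suc j))) (half n)

9^-valuation : ∀ d → Valuation (9 ^ d) (2 * d)
9^-valuation d = subst (λ x → Valuation x (2 * d)) (sym (^-*-assoc 3 2 d)) (valuation-3^ (2 * d))

W-coefficient : ∀ n i d → i + d ≡ half n → W n i ≡ 9 ^ d * T n i
W-coefficient n i d i+d≡ =
  subst (λ k → ∏ (λ j → X+ (9 * a j)) k i ≡ 9 ^ d * ∏ (X+ ∘ a) k i) i+d≡ (∏-X+-scale 9 a i d)
  where
  a : ℕ → ℕ
  a j = node (3 ^ n) (suc j)

T-valuation : ∀ n l → l ≤ half n → Valuation (T n l) (V n l)
T-valuation zero .0 z≤n = valuation-3^ 0
T-valuation (suc n) l l≤ = subst (λ x → Valuation x (V (suc n) l)) (sym (T-suc n l)) product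
  where
  W-valuation : ∀ i d → i + d ≡ half n → Valuation (W n i) (2 * d + V n i)
  W-valuation i d i+d≡ = subst (λ x → Valuation x (2 * d + V n i)) (sym (W-coefficient n i d i+d≡))
    (valuation-* (9^-valuation d) (T-valuation n i (subst (i ≤_) i+d≡ (m≤m+n i d))))

  product : Valuation ((U n ⊛ W n) l) (V (suc n) l)
  product with position (half n) l
  ... | low e l+e≡h = subst (Valuation _) (sym (V-low n l e l+e≡h))
        (⊛-dominated (U n) (W n) 0 l (valuation-* (U-valuation-0 n) (W-valuation l e l+e≡h)) others)
    where
    others : ∀ i j → i + j ≡ l → i ≢ 0 → 3 ^ suc (2 * e + V n l) ∣ U n i * W n j
    others i j refl i≢0 = 3^∣* {n ∸ v3 i} {2 * (i + e) + V n j}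
      (valuation-∣ (U-valuation n 0<i i≤))
      (valuation-∣ (W-valuation j (i + e) (trans (rearrange₁ i j e) l+e≡h))) (begin-strict
        2 * e + V n (i + j)                       ≡⟨ cong (λ x → 2 * e + V n x) (+-comm i j) ⟩
        2 * e + V n (j + i)
          <⟨ +-monoʳ-< (2 * e) (V-shift-< n j i 0<i (subst (_≤ half n) (+-comm i j) l≤h)) ⟩
        2 * e + (2 * i + (n ∸ v3 i) + V n j)      ≡⟨ rearrange₂ e i (n ∸ v3 i) (V n j) ⟩
        n ∸ v3 i + (2 * (i + e) + V n j)          ∎)
      where
      open ≤-Reasoning
      0<i : 0 < i
      0<i = n≢0⇒n>0 i≢0
      l≤h : i + j ≤ half n
      l≤h = subst (i + j ≤_) l+e≡h (m≤m+n (i + j) e)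
      i≤ : i ≤ 3 ^ n
      i≤ = <⇒≤ (≤-<-trans (≤-trans (m≤m+n i j) l≤h) (half<3^ n))
      rearrange₁ : ∀ i j e → j + (i + e) ≡ i + j + e
      rearrange₁ = solve-∀
      rearrange₂ : ∀ e i a b → 2 * e + (2 * i + a + b) ≡ a + (2 * (i + e) + b)
      rearrange₂ = solve-∀
  ... | high r 0<r refl = subst₂ (λ k → Valuation ((U n ⊛ W n) k)) (+-comm r (half n)) e≡
        (⊛-dominated (U n) (W n) r (half n)
          (valuation-* (U-valuation n 0<r r≤) (W-valuation (half n) 0 (+-identityʳ (half n)))) others)
    where
    r≤ : r ≤ 3 ^ n
    r≤ = +-cancelˡ-≤ (half n) r (3 ^ n) (subst (half n + r ≤_) (half-suc n) l≤)

    e = n ∸ v3 r + (2 * 0 + V n (half n))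
    e≡n∸v3r : e ≡ n ∸ v3 r
    e≡n∸v3r = trans (cong (n ∸ v3 r +_) (V-half n)) (+-identityʳ (n ∸ v3 r))
    e≡ : e ≡ V (suc n) (half n + r)
    e≡ = trans e≡n∸v3r (sym (V-high n 0<r))

    -- If v₃(r + d) ≤ v₃(r), the U factor loses nothing. Otherwise v₃(d) ≤ v₃(r), and by
    -- `V-below-half` the W factor alone exceeds n - v₃(r).
    inner : ∀ j d → 0 < d → j + d ≡ half n → n ∸ v3 r < n ∸ v3 (r + d) + (2 * d + V n j)
    inner j d@(suc _) 0<d j+d≡h with ≤-<-connex (v3 (r + d)) (v3 r)
    ... | inj₁ v≤ = begin-strict
      n ∸ v3 r                                ≤⟨ ∸-monoʳ-≤ n v≤ ⟩
      n ∸ v3 (r + d)                          <⟨ m<m+n (n ∸ v3 (r + d)) (s≤s z≤n) ⟩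
      n ∸ v3 (r + d) + (2 * d + V n j)        ∎
      where open ≤-Reasoning
    ... | inj₂ v< = begin-strict
      n ∸ v3 r                          <⟨ m<n+o⇒m∸n<o n (v3 r) (begin-strict
        n                               <⟨ V-below-half n j d 0<d j+d≡h ⟩
        2 * d + v3 d + V n j            ≤⟨ +-monoˡ-≤ (V n j) (+-monoʳ-≤ (2 * d) v3d≤v3r) ⟩
        2 * d + v3 r + V n j            ≡⟨ rearrange (2 * d) (v3 r) (V n j) ⟩
        v3 r + (2 * d + V n j)          ∎) ⟩
      2 * d + V n j                     ≤⟨ m≤n+m (2 * d + V n j) (n ∸ v3 (r + d)) ⟩
      n ∸ v3 (r + d) + (2 * d + V n j)  ∎
      where
      open ≤-Reasoning
      v3d≤v3r : v3 d ≤ v3 r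
      v3d≤v3r = ≮⇒≥ λ v3r<v3d → <⇒≢ v< (sym (v3-+ 0<r 0<d v3r<v3d))
      rearrange : ∀ a b c → a + b + c ≡ b + (a + c)
      rearrange = solve-∀

    others : ∀ i j → i + j ≡ r + half n → i ≢ r → 3 ^ suc e ∣ U n i * W n j
    others i j i+j≡ i≢r with position (half n) j
    ... | high s 0<s refl = subst (3 ^ suc e ∣_)
          (sym (trans (cong (U n i *_) (∏-X+-> (λ j → 9 * node (3 ^ n) (suc j)) (half n) (m<m+n (half n) 0<s))) (*-zeroʳ (U n i))))
          ((3 ^ suc e) ∣0)
    ... | low d j+d≡h with ≤-<-connex i (3 ^ n)
    ...   | inj₂ 3^n<i = ∣m⇒∣m*n (W n j) (∣-trans (3^-mono-∣ (s≤s (subst (_≤ n) (sym e≡n∸v3r) (m∸n≤m n (v3 r))))) (U-∣-beyond n 3^n<i))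
    ...   | inj₁ i≤3^n = 3^∣* {n ∸ v3 i} {2 * d + V n j}
            (valuation-∣ (U-valuation n (≤-trans 0<r (subst (r ≤_) (sym i≡) (m≤m+n r d))) i≤3^n))
            (valuation-∣ (W-valuation j d j+d≡h))
            (subst₂ (λ x y → x < n ∸ v3 y + (2 * d + V n j)) (sym e≡n∸v3r) (sym i≡)
              (inner j d (n≢0⇒n>0 λ d≡0 → i≢r (trans i≡ (trans (cong (r +_) d≡0) (+-identityʳ r)))) j+d≡h))
      where
      i≡ : i ≡ r + d
      i≡ = +-cancelʳ-≡ j i (r + d) (trans i+j≡ (trans (cong (r +_) (trans (sym j+d≡h) (+-comm j d))) (sym (+-assoc r d j))))

-- Stirling numbers

q^ : ℕ → ℕ → Series
q^ N = ∏ (λ _ → quadratic N)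

q^-zero : ∀ N m → q^ N (suc m) 0 ≡ 0
q^-zero N m = *-zeroʳ (q^ N m 0)

q^-suc : ∀ N m i → q^ N (suc m) (suc i) ≡ (X+ N ⊛ q^ N m) i
q^-suc N m i = begin
  (q^ N m ⊛ (X ⊛ X+ N)) (suc i) ≡⟨ ⊛-comm (q^ N m) (X ⊛ X+ N) (suc i) ⟩
  (X ⊛ X+ N ⊛ q^ N m) (suc i)   ≡⟨ ⊛-assoc X (X+ N) (q^ N m) (suc i) ⟩
  (X ⊛ (X+ N ⊛ q^ N m)) (suc i) ≡⟨ X-⊛-suc (X+ N ⊛ q^ N m) i ⟩
  (X+ N ⊛ q^ N m) i             ∎
  where open ≡-Reasoning

q^-suc² : ∀ N m i → q^ N (suc m) (2 + i) ≡ q^ N m i + N * q^ N m (suc i)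
q^-suc² N m i = trans (q^-suc N m (suc i)) (X+-⊛-suc N (q^ N m) i)

q^-> : ∀ N m {i} → m + m < i → q^ N m i ≡ 0
q^-> N zero    {suc i} _ = refl
q^-> N (suc m) {suc zero} (s≤s ())
q^-> N (suc m) {suc (suc i)} 2m+2<i =
  trans (q^-suc² N m i)
    (trans (cong₂ (λ x y → x + N * y) (q^-> N m 2m<i) (q^-> N m (m<n⇒m<1+n 2m<i))) (*-zeroʳ N))
  where
  2m<i : m + m < i
  2m<i = ≤-pred (subst (_< suc i) (+-suc m m) (≤-pred 2m+2<i))

q^-lead : ∀ N m → q^ N m (m + m) ≡ 1
q^-lead N zero = refl
q^-lead N (suc m) rewrite +-suc m m | q^-suc² N m (m + m) | q^-lead N m | q^-> N m (n<1+n (m + m)) =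
  cong suc (*-zeroʳ N)

-- Source of the summand v₃(l) + n in the valuation for k = 2 l.
q^-sublead : ∀ N m → q^ N (suc m) (suc (m + m)) ≡ suc m * N
q^-sublead N zero = trans (q^-suc N 0 0) (trans (*-identityʳ N) (sym (+-identityʳ N)))
q^-sublead N (suc m) rewrite +-suc m m | q^-suc² N (suc m) (suc (m + m)) | q^-sublead N m =
  trans (cong (λ x → suc m * N + N * x) (trans (cong (q^ N (suc m)) (sym (cong suc (+-suc m m)))) (q^-lead N (suc m))))
    (rearrange m N)
  where
  rearrange : ∀ m N → suc m * N + N * 1 ≡ suc (suc m) * N
  rearrange = solve-∀

-- With x and N both given degree 1, (x² + N x)^m is homogeneous of degree 2 m.
q^-∣ : ∀ N m i e → i + e ≡ m + m → N ^ e ∣ q^ N m i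
q^-∣ N zero    zero zero _ = ∣-refl
q^-∣ N (suc m) zero e _ = subst (N ^ e ∣_) (sym (q^-zero N m)) ((N ^ e) ∣0)
q^-∣ N (suc m) (suc zero) zero _ = 1∣ _
q^-∣ N (suc m) (suc zero) (suc e) eq = subst (N * N ^ e ∣_) (sym (q^-suc N m 0))
  (*-monoʳ-∣ N (q^-∣ N m 0 e (suc-injective (trans (suc-injective eq) (+-suc m m)))))
q^-∣ N (suc m) (suc (suc i)) zero _ = 1∣ _
q^-∣ N (suc m) (suc (suc i)) (suc e) eq = subst (N * N ^ e ∣_) (sym (q^-suc² N m i))
  (∣m∣n⇒∣m+n (q^-∣ N m i (suc e) 2m≡) (*-monoʳ-∣ N (q^-∣ N m (suc i) e (trans (sym (+-suc i e)) 2m≡))))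
  where
  2m≡ : i + suc e ≡ m + m
  2m≡ = suc-injective (trans (suc-injective eq) (+-suc m m))

stirling-expansion : ∀ n i →
  stirling1 (3 ^ n) (suc i) ≡ ∑ (λ m → const (T n m) ⊛ q^ (3 ^ n) m) (suc (half n)) i
stirling-expansion n i = begin
  stirling1 N (suc i)                      ≡⟨ stirling1≡∏ N (suc i) ⟩
  ∏ X+ N (suc i)                           ≡⟨ cong (λ k → ∏ X+ k (suc i)) N≡ ⟩
  -- Of the 2 M + 1 factors, the one equal to x is split off, which lowers the index by 1; the
  -- remaining 2 M are paired.
  ∏ X+ (suc (M + M)) (suc i)               ≡⟨ ∏-head X+ (M + M) (suc i) ⟩
  (X+ 0 ⊛ ∏ (X+ ∘ suc) (M + M)) (suc i)    ≡⟨ X+-⊛-suc 0 (∏ (X+ ∘ suc) (M + M)) i ⟩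
  ∏ (X+ ∘ suc) (M + M) i + 0               ≡⟨ +-identityʳ _ ⟩
  ∏ (X+ ∘ suc) (M + M) i                   ≡⟨ paired i ⟩
  ∏ (λ j → quadratic N ⊕ const (a j)) M i  ≡⟨ ∏-quadratic (quadratic N) a M i ⟩
  _                                        ∎
  where
  open ≡-Reasoning
  N = 3 ^ n
  M = half n
  N≡ = 3^≡1+2half n
  a : ℕ → ℕ
  a j = node N (suc j)
  pair : ∀ j j′ → j + j′ ≡ N → X+ j ⊛ X+ j′ ≗ quadratic N ⊕ const (j * j′)
  pair j j′ j+j′≡N = S.trans (vieta-pair X (const j) (const j′))
    (S.+-cong (S.*-congˡ {X} (S.+-congˡ {X} (S.trans (S.sym (const-+ j j′)) (S.reflexive (cong const j+j′≡N)))))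
      (S.sym (const-* j j′)))
  paired : ∏ (X+ ∘ suc) (M + M) ≗ ∏ (λ j → quadratic N ⊕ const (a j)) M
  paired = S.trans (∏-+ (X+ ∘ suc) M M)
    (S.trans (S.*-congˡ {∏ (X+ ∘ suc) M} (∏-reverse (λ j → X+ (suc (M + j))) M))
    (S.trans (S.sym (∏-* (X+ ∘ suc) (λ j → X+ (suc (M + (M ∸ suc j)))) M))
      (∏-cong M λ j j<M → S.trans (S.*-congˡ {X+ (suc j)} (S.reflexive (cong X+ (half-reflect n j<M))))
        (pair (suc j) (N ∸ suc j) (m+[n∸m]≡n (≤-trans j<M (<⇒≤ (half<3^ n))))))))

-- i is 2 l or 2 l − 1, so that the terms with m < l vanish.
expansion-valuation : ∀ n i l {e} → l ≤ half n → (∀ {m} → m < l → m + m < i) →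
  Valuation (T n l * q^ (3 ^ n) l i) e →
  (∀ j → 0 < j → l + j ≤ half n → 3 ^ suc e ∣ T n (l + j) * q^ (3 ^ n) (l + j) i) →
  Valuation (stirling1 (3 ^ n) (suc i)) e
expansion-valuation n i l {e} l≤ below main above =
  subst (λ x → Valuation x e) (sym (stirling-expansion n i))
    (∑-dominated term i l (suc (half n)) (s≤s l≤) (subst (λ x → Valuation x e) (sym (term≡ l)) main)
      λ m m≤ m≢l → subst (3 ^ suc e ∣_) (sym (term≡ m)) (others m (≤-pred m≤) m≢l))
  where
  term : ℕ → Series
  term m = const (T n m) ⊛ q^ (3 ^ n) m
  term≡ : ∀ m → term m i ≡ T n m * q^ (3 ^ n) m i
  term≡ m = const-⊛ (T n m) (q^ (3 ^ n) m) i
  others : ∀ m → m ≤ half n → m ≢ l → 3 ^ suc e ∣ T n m * q^ (3 ^ n) m i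
  others m m≤ m≢l with <-cmp m l
  ... | tri< m<l _ _ = subst (3 ^ suc e ∣_)
        (sym (trans (cong (T n m *_) (q^-> (3 ^ n) m (below m<l))) (*-zeroʳ (T n m)))) ((3 ^ suc e) ∣0)
  ... | tri≈ _ m≡l _ = contradiction m≡l m≢l
  ... | tri> _ _ l<m = subst (λ m → 3 ^ suc e ∣ T n m * q^ (3 ^ n) m i) l+[m∸l]≡m
        (above (m ∸ l) (m<n⇒0<n∸m l<m) (subst (_≤ half n) (sym l+[m∸l]≡m) m≤))
    where
    l+[m∸l]≡m = m+[n∸m]≡n (<⇒≤ l<m)

N^e∣⇒ : ∀ n e {x} → (3 ^ n) ^ e ∣ x → 3 ^ (n * e) ∣ x
N^e∣⇒ n e = subst (_∣ _) (^-*-assoc 3 n e)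

stirling-odd : ∀ n l → l ≤ half n → Valuation (stirling1 (3 ^ n) (suc (l + l))) (V n l)
stirling-odd n l l≤ = expansion-valuation n (l + l) l l≤ (λ m<l → +-mono-< m<l m<l)
  (subst₂ Valuation (sym (trans (cong (T n l *_) (q^-lead N l)) (*-identityʳ (T n l)))) refl (T-valuation n l l≤))
  (above l)
  where
  N = 3 ^ n
  above : ∀ l j → 0 < j → l + j ≤ half n → 3 ^ suc (V n l) ∣ T n (l + j) * q^ N (l + j) (l + l)
  above zero (suc j) _ _ = subst (3 ^ suc (V n 0) ∣_)
    (sym (trans (cong (T n (suc j) *_) (q^-zero N j)) (*-zeroʳ (T n (suc j))))) ((3 ^ suc (V n 0)) ∣0)
  above l@(suc _) j 0<j l+j≤ = 3^∣* {V n (l + j)} {n * (j + j)}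
    (valuation-∣ (T-valuation n (l + j) l+j≤))
    (N^e∣⇒ n (j + j) (q^-∣ N (l + j) (l + l) (j + j) (rearrange₁ l j))) (begin-strict
      V n l                           ≤⟨ m≤m+n (V n l) (v3 l) ⟩
      V n l + v3 l                    <⟨ V-slope n l j (s≤s z≤n) 0<j l+j≤ ⟩
      2 * (j * n) + V n (l + j)       ≡⟨ rearrange₂ j n (V n (l + j)) ⟩
      V n (l + j) + n * (j + j)       ∎)
    where
    open ≤-Reasoning
    rearrange₁ : ∀ l j → l + l + (j + j) ≡ l + j + (l + j)
    rearrange₁ = solve-∀
    rearrange₂ : ∀ j n x → 2 * (j * n) + x ≡ x + n * (j + j)
    rearrange₂ = solve-∀

-- The relevant index is one below the degree of the main power, so the main term carries (l + 1) N
-- and its competitors N^(2 j + 1). The common n cancels, which leaves `V-slope`.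
stirling-even : ∀ n l → suc l ≤ half n →
                Valuation (stirling1 (3 ^ n) (2 + (l + l))) (V n (suc l) + (v3 (suc l) + n))
stirling-even n l l< = expansion-valuation n (suc (l + l)) (suc l) l<
  (λ m<1+l → s≤s (+-mono-≤ (≤-pred m<1+l) (≤-pred m<1+l)))
  (valuation-* (T-valuation n (suc l) l<)
    (subst (λ x → Valuation x (v3 (suc l) + n)) (sym (q^-sublead N l))
      (valuation-* (v3-valuation {suc l} λ ()) (valuation-3^ n))))
  λ j 0<j l+j≤ → 3^∣* {V n (suc l + j)} {n * suc (j + j)}
    (valuation-∣ (T-valuation n (suc l + j) l+j≤))
    (N^e∣⇒ n (suc (j + j)) (q^-∣ N (suc l + j) (suc (l + l)) (suc (j + j)) (rearrange₁ l j))) (begin-strict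
      V n (suc l) + (v3 (suc l) + n)        ≡⟨ +-assoc (V n (suc l)) (v3 (suc l)) n ⟨
      V n (suc l) + v3 (suc l) + n          <⟨ +-monoˡ-< n (V-slope n (suc l) j (s≤s z≤n) 0<j l+j≤) ⟩
      2 * (j * n) + V n (suc l + j) + n     ≡⟨ rearrange₂ j n (V n (suc l + j)) ⟩
      V n (suc l + j) + n * suc (j + j)     ∎)
  where
  open ≤-Reasoning
  N = 3 ^ n
  rearrange₁ : ∀ l j → suc (l + l) + suc (j + j) ≡ suc l + j + (suc l + j)
  rearrange₁ = solve-∀
  rearrange₂ : ∀ j n x → 2 * (j * n) + x + n ≡ x + n * suc (j + j)
  rearrange₂ = solve-∀

-- Both parities of k, and the theorem

data Parity : ℕ → Set where
  even : ∀ l → Parity (l + l)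
  odd  : ∀ l → Parity (suc (l + l))

parity : ∀ k → Parity k
parity zero = even 0
parity (suc k) with parity k
... | even l = odd l
... | odd l  = subst Parity (cong suc (+-suc l l)) (even (suc l))

v3-stirling-1 : ∀ n → v3 (stirling1 (3 ^ n) 1) ≡ V n 0
v3-stirling-1 n = valuation⇒v3 (stirling-odd n 0 z≤n)

v3-stirling-≤ : ∀ m k → let n = 3 + m in 1 ≤ k → k ≤ 3 ^ n → v3 (stirling1 (3 ^ n) k) ≤ V n 0
v3-stirling-≤ m k@(suc i) _ k≤ with parity i
... | even l = subst (_≤ V n 0) (sym (valuation⇒v3 (stirling-odd n l l≤))) (bound l l≤)
  where
  n = 3 + m
  l≤ : l ≤ half n
  l≤ = ≮⇒≥ λ h<l → <⇒≱ (+-mono-< h<l h<l) (≤-pred (subst (suc (l + l) ≤_) (3^≡1+2half n) k≤))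
  bound : ∀ l → l ≤ half n → V n l ≤ V n 0
  bound zero    _  = ≤-refl
  bound (suc l) l≤ = ≤-trans (m≤m+n _ (v3 (suc l))) (≤-trans (m≤m+n _ n) (V-max m (suc l) (s≤s z≤n) l≤))
... | odd l = subst (_≤ V n 0) (sym (valuation⇒v3 (stirling-even n l l<)))
      (subst (_≤ V n 0) (+-assoc (V n (suc l)) (v3 (suc l)) n) (V-max m (suc l) (s≤s z≤n) l<))
  where
  n = 3 + m
  l< : l < half n
  l< = ≰⇒> λ h≤l → <⇒≱ (s≤s (+-mono-≤ h≤l h≤l)) (≤-pred (subst (suc (suc (l + l)) ≤_) (3^≡1+2half n) k≤))

theorem1p4 : (n k : ℕ) → 1 ≤ n → 1 ≤ k → k ≤ 3 ^ n →
    (3 ≤ n → v3 (stirling1 (3 ^ n) k) ≤ v3 (stirling1 (3 ^ n) 1)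
    × 2 * v3 (stirling1 (3 ^ n) 1) ≡ 3 ^ n ∸ (2 * n + 1))
    × (n ≡ 2 → v3 (stirling1 (3 ^ 2) k) ≤ v3 (stirling1 (3 ^ 2) 6)
    × v3 (stirling1 (3 ^ 2) 6) ≡ 4)
    × (n ≡ 1 → v3 (stirling1 3 k) ≤ v3 (stirling1 3 2)
    × v3 (stirling1 3 2) ≡ 1)
theorem1p4 n k _ 1≤k k≤ = n≥3 , n≡2 , n≡1
  where
  n≥3 : 3 ≤ n → _ × _
  n≥3 3≤n = subst (v3 (stirling1 (3 ^ n) k) ≤_) (sym (v3-stirling-1 n))
      (subst (λ n → k ≤ 3 ^ n → v3 (stirling1 (3 ^ n) k) ≤ V n 0) (m+[n∸m]≡n 3≤n) (v3-stirling-≤ (n ∸ 3) k 1≤k) k≤)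
    , trans (cong (2 *_) (v3-stirling-1 n))
        (trans (sym (m+n∸n≡m (2 * V n 0) (2 * n + 1))) (cong (_∸ (2 * n + 1)) (V-zero n)))
  n≡2 : n ≡ 2 → _ × _
  -- Evaluation for all k below 10 = 3² + 1; the bound 4 is the computed valuation of s(9, 6).
  n≡2 refl = from-yes (allUpTo? (λ k → v3 (stirling1 9 k) ≤? 4) 10) (s≤s k≤) , refl
  n≡1 : n ≡ 1 → _ × _
  n≡1 refl = from-yes (allUpTo? (λ k → v3 (stirling1 3 k) ≤? 1) 4) (s≤s k≤) , refl
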